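{- Let $I$ be a non-empty descent set, $s=s(I)$, $w=w(I)$, and $(C_0,\ldots,C_s)$ its Naruse-Newton coefficients. Then $$\frac{C_0}{0!}=\frac{C_1}{1!}=\cdots=\frac{C_w}{w!}>\frac{C_{w+1}}{(w+1)!}>\cdots>\frac{C_s}{s!};$$ that is, $\frac{C_j}{j!}=\frac{C_{j+1}}{(j+1)!}$ for all integers $0\le j<\min(w,s)$, and $\frac{C_j}{j!}>\frac{C_{j+1}}{(j+1)!}$ for all integers $w\le j<s$.
   Context: Partitions are drawn as Young diagrams $\mathbb{D}(\lambda)$ in English notation; $c_{i,j}$ is the cell in row $i$, column $j$; $\lambda'$ is the conjugate partition ($\lambda'_j$ = number of cells in column $j$). The hook length $h_\lambda(c)$ is the number of cells of $\mathbb{D}(\lambda)$ weakly right of $c$ in its row or weakly below $c$ in its column (counting $c$ once). For $\mu\subseteq\lambda$, an excited diagram of $\lambda/\mu$ is a subset of $\mathbb{D}(\lambda)$ obtained from $\mathbb{D}(\mu)$ by repeatedly replacing a cell $c_{i,j}\in D$ by $c_{i+1,j+1}$, allowed iff $c_{i+1,j+1}\in\mathbb{D}(\lambda)$ and none of $c_{i,j+1},c_{i+1,j},c_{i+1,j+1}$ lies in $D$; $\mathbb{E}(\lambda/\mu)$ is their set. A ribbon with $n$ cells is read from its lower-left to its upper-right cell, each successive cell directly right of or directly above the previous; it corresponds to the set of $i\in\{1,\ldots,n-1\}$ with cell $i$ directly below cell $i+1$. A descent set is a non-empty finite set $I$ of positive integers; $\lambda^I$ is the unique partition with $\lambda^I_1=\lambda^I_2$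 such that the cells $c_{i,j}\in\mathbb{D}(\lambda^I)$ with fewer than three of $c_{i,j+1},c_{i+1,j},c_{i+1,j+1}$ in $\mathbb{D}(\lambda^I)$ form a ribbon corresponding to $I$; this ribbon is $\mathbb{D}(\lambda^I)\setminus\mathbb{D}(\mu^I)$ for a partition $\mu^I$. Let $s(I)=\lambda^I_1-1$. Naruse-Newton coefficients: every excited diagram of $\lambda^I/\mu^I$ meets row 1 in $\{c_{1,1},\ldots,c_{1,r}\}$, $0\le r\le s$; for $0\le j\le s(I)$, $C_j(I)=\sum_D\prod_{c\in D,\,c\notin\text{row }1}h_{\lambda^I}(c)$, summed over $D\in\mathbb{E}(\lambda^I/\mu^I)$ with exactly $s-j$ cells in row 1. $w(I)$ is the number of integers $j$ with $1\le j\le s(I)+1$ and $(\lambda^I)'_j=2$. -}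

module Defs where

open import Data.Integer.Base using (+_)
open import Data.List.Base using (List; []; _∷_; _++_; [_]; map; filter; length; upTo; concatMap; cartesianProduct)
open import Data.List.Membership.Propositional using (_∈_; _∉_; find; lose)
open import Data.List.Membership.Propositional.Properties
  using (∈-filter⁺; ∈-filter⁻; ∈-map⁺; ∈-map⁻; ∈-concatMap⁺; ∈-concatMap⁻)
open import Data.List.Membership.Propositional.Properties.WithK using (unique∧set⇒bag)
open import Data.List.Properties using (≡-dec)
open import Data.List.Relation.Binary.BagAndSetEquality using (∼bag⇒↭)
open import Data.List.Relation.Binary.Permutation.Propositional.Properties using (map⁺)
open import Data.List.Relation.Unary.All as All using (All)
open import Data.List.Relation.Unary.AllPairs using (_∷_)
open import Data.List.Relation.Unary.Any using (here; there; any?)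
open import Data.List.Relation.Unary.Linked using (Linked)
open import Data.List.Relation.Unary.Unique.Propositional using (Unique)
import Data.List.Relation.Unary.Unique.Propositional.Properties as Unique
open import Data.Nat.Base using (ℕ; zero; suc; _+_; _∸_; _≤_; _<_; _≥_; _!)
open import Data.Nat.ListAction using (sum; product)
open import Data.Nat.ListAction.Properties using (sum-↭)
open import Data.Nat.Properties using (_≟_; _≤?_; _<?_; _!≢0; m+n∸n≡m)
open import Data.Product.Base using (_×_; _,_; proj₁; proj₂; ∃-syntax)
open import Data.Product.Properties using () renaming (≡-dec to ×-≡-dec)
open import Data.Rational.Base using (ℚ; _/_)
open import Data.Sum.Base using (_⊎_; inj₁; inj₂)
open import Function.Base using (_∘_)
open import Function.Bundles using (_⇔_; mk⇔)
open import Relation.Binary.Definitions using (DecidableEquality)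
open import Relation.Binary.PropositionalEquality using (_≡_; _≢_; refl; sym; trans; cong; subst)
open import Relation.Nullary using (Dec; yes; no)
open import Relation.Nullary.Decidable using (_×-dec_; _⊎-dec_; ¬?; map′)

-- Rows and columns are numbered from 0: the pair (i , j) is the cell c_{i+1,j+1}.
Cell : Set
Cell = ℕ × ℕ

_≟ᶜ_ : DecidableEquality Cell
_≟ᶜ_ = ×-≡-dec _≟_ _≟_

_∈ᶜ?_ : (c : Cell) (D : List Cell) → Dec (c ∈ D)
c ∈ᶜ? D = any? (c ≟ᶜ_) D

right below diagonal : Cell → Cell
right    (i , j) = i , suc j
below    (i , j) = suc i , j
diagonal (i , j) = suc i , suc j

record Partition : Set where
  field
    parts      : List ℕ
    decreasing : Linked _≥_ parts
    positive   : All (0 <_) parts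
open Partition public

partAt : List ℕ → ℕ → ℕ
partAt []       _       = 0
partAt (p ∷ _)  zero    = p
partAt (_ ∷ ps) (suc i) = partAt ps i

part : Partition → ℕ → ℕ
part Λ = partAt (parts Λ)

inRow? : (Λ : Partition) (c : Cell) → Dec (proj₂ c < part Λ (proj₁ c))
inRow? Λ (i , j) = j <? part Λ i

-- Listed without repetition, row by row.
𝔻 : Partition → List Cell
𝔻 Λ = filter (inRow? Λ) (cartesianProduct (upTo (length (parts Λ))) (upTo (part Λ 0)))

𝔻-unique : ∀ Λ → Unique (𝔻 Λ)
𝔻-unique Λ = Unique.filter⁺ _ (Unique.cartesianProduct⁺ (Unique.upTo⁺ (length (parts Λ))) (Unique.upTo⁺ (part Λ 0)))

_⊆ᴾ_ : Partition → Partition → Set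
μ ⊆ᴾ Λ = ∀ c → c ∈ 𝔻 μ → c ∈ 𝔻 Λ

conjugate : Partition → ℕ → ℕ
conjugate Λ j = length (filter (λ c → proj₂ c ≟ j) (𝔻 Λ))

InHook : Cell → Cell → Set
InHook (i , j) (k , l) = (k ≡ i × j ≤ l) ⊎ (l ≡ j × i ≤ k)

inHook? : ∀ c d → Dec (InHook c d)
inHook? (i , j) (k , l) = ((k ≟ i) ×-dec (j ≤? l)) ⊎-dec ((l ≟ j) ×-dec (i ≤? k))

hook : Partition → Cell → ℕ
hook Λ c = length (filter (inHook? c) (𝔻 Λ))

-- A subset of 𝔻 Λ is represented by the list of its cells in the order in
-- which 𝔻 Λ lists them, so that equality of lists is equality of subsets.

subsets : {A : Set} → List A → List (List A)
subsets []       = [ [] ]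
subsets (x ∷ xs) = map (x ∷_) (subsets xs) ++ subsets xs

-- The cells of 𝔻 μ, as a subset of 𝔻 Λ (for μ ⊆ᴾ Λ).
initial : Partition → Partition → List Cell
initial Λ μ = filter (_∈ᶜ? 𝔻 μ) (𝔻 Λ)

Excitable : Partition → List Cell → Cell → Set
Excitable Λ D c = c ∈ D × diagonal c ∈ 𝔻 Λ × right c ∉ D × below c ∉ D × diagonal c ∉ D

-- (D ∖ {c}) ∪ {diagonal c}
excite : Partition → List Cell → Cell → List Cell
excite Λ D c = filter (λ x → (x ∈ᶜ? (diagonal c ∷ D)) ×-dec ¬? (x ≟ᶜ c)) (𝔻 Λ)

data Excited (Λ μ : Partition) : List Cell → Set where
  start : Excited Λ μ (initial Λ μ)
  move  : ∀ {D} c → Excited Λ μ D → Excitable Λ D c → Excited Λ μ (excite Λ D c)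

excited-⊆ : ∀ {Λ μ D} → Excited Λ μ D → ∀ {x} → x ∈ D → x ∈ 𝔻 Λ
excited-⊆ {μ = μ} start    = proj₁ ∘ ∈-filter⁻ (_∈ᶜ? 𝔻 μ)
excited-⊆ {Λ} (move _ _ _) = proj₁ ∘ ∈-filter⁻ _ {xs = 𝔻 Λ}

excited-unique : ∀ {Λ μ D} → Excited Λ μ D → Unique D
excited-unique {Λ} start        = Unique.filter⁺ _ (𝔻-unique Λ)
excited-unique {Λ} (move _ _ _) = Unique.filter⁺ _ (𝔻-unique Λ)

-- Being excited is decidable: a move raises the sum of the row indices by
-- exactly one, which fixes the number of moves leading to a given D.
private
  excitable? : ∀ Λ D c → Dec (Excitable Λ D c)
  excitable? Λ D c = (c ∈ᶜ? D) ×-dec (diagonal c ∈ᶜ? 𝔻 Λ) ×-dec ¬? (right c ∈ᶜ? D)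
                     ×-dec ¬? (below c ∈ᶜ? D) ×-dec ¬? (diagonal c ∈ᶜ? D)

  successors : Partition → List Cell → List (List Cell)
  successors Λ D = map (excite Λ D) (filter (excitable? Λ D) (𝔻 Λ))

  after : Partition → Partition → ℕ → List (List Cell)
  after Λ μ zero    = [ initial Λ μ ]
  after Λ μ (suc k) = concatMap (successors Λ) (after Λ μ k)

  rowSum : List Cell → ℕ
  rowSum D = sum (map proj₁ D)

  _without_ : List Cell → Cell → List Cell
  D without c = filter (λ x → ¬? (x ≟ᶜ c)) D

  rowSum-cong : ∀ {D E} → Unique D → Unique E → (∀ {x} → x ∈ D ⇔ x ∈ E) → rowSum D ≡ rowSum E
  rowSum-cong u v eq = sum-↭ (map⁺ proj₁ (∼bag⇒↭ (unique∧set⇒bag u v eq)))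

  without-unique : ∀ {D} x c → Unique D → x ∉ D without c → Unique (x ∷ D without c)
  without-unique x c u x∉ =
    All.tabulate (λ y∈ x≡y → x∉ (subst (_∈ _) (sym x≡y) y∈)) ∷ Unique.filter⁺ _ u

  rowSum-remove : ∀ {D c} → Unique D → c ∈ D → rowSum D ≡ proj₁ c + rowSum (D without c)
  rowSum-remove {D} {c} u c∈D =
    rowSum-cong u (without-unique c c u (λ c∈ → proj₂ (∈-filter⁻ P? {xs = D} c∈) refl)) (mk⇔ to from)
    where
    P? : (x : Cell) → Dec (x ≢ c)
    P? x = ¬? (x ≟ᶜ c)
    to : ∀ {x} → x ∈ D → x ∈ c ∷ D without c
    to {x} x∈ with x ≟ᶜ c
    ... | yes x≡c = here x≡c
    ... | no  x≢c = there (∈-filter⁺ P? x∈ x≢c)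
    from : ∀ {x} → x ∈ c ∷ D without c → x ∈ D
    from (here refl) = c∈D
    from (there x∈)  = proj₁ (∈-filter⁻ P? x∈)

  rowSum-excite : ∀ {Λ μ D} c → Excited Λ μ D → Excitable Λ D c →
                  rowSum (excite Λ D c) ≡ suc (rowSum D)
  rowSum-excite {Λ} {μ} {D} c e (c∈D , d∈Λ , _ , _ , d∉D) =
    trans (rowSum-cong (Unique.filter⁺ _ (𝔻-unique Λ))
                       (without-unique (diagonal c) c u (d∉D ∘ proj₁ ∘ ∈-filter⁻ P?))
                       (mk⇔ to from))
          (cong suc (sym (rowSum-remove u c∈D)))
    where
    u = excited-unique e
    P? : (x : Cell) → Dec (x ≢ c)
    P? x = ¬? (x ≟ᶜ c)
    Q? : (x : Cell) → Dec (x ∈ diagonal c ∷ D × x ≢ c)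
    Q? x = (x ∈ᶜ? (diagonal c ∷ D)) ×-dec ¬? (x ≟ᶜ c)
    to : ∀ {x} → x ∈ excite Λ D c → x ∈ diagonal c ∷ D without c
    to x∈ with ∈-filter⁻ Q? {xs = 𝔻 Λ} x∈
    ... | _ , here x≡d  , _   = here x≡d
    ... | _ , there x∈D , x≢c = there (∈-filter⁺ P? x∈D x≢c)
    from : ∀ {x} → x ∈ diagonal c ∷ D without c → x ∈ excite Λ D c
    from (here refl) = ∈-filter⁺ Q? d∈Λ (here refl , λ ())
    from (there x∈) with ∈-filter⁻ P? {xs = D} x∈
    ... | x∈D , x≢c = ∈-filter⁺ Q? (excited-⊆ e x∈D) (there x∈D , x≢c)

  after-sound : ∀ Λ μ k {D} → D ∈ after Λ μ k → Excited Λ μ D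
  after-sound Λ μ zero    (here refl) = start
  after-sound Λ μ (suc k) D∈ with find (∈-concatMap⁻ (successors Λ) {xs = after Λ μ k} D∈)
  ... | E , E∈ , D∈′ with ∈-map⁻ (excite Λ E) D∈′
  ... | c , c∈ , refl = move c (after-sound Λ μ k E∈) (proj₂ (∈-filter⁻ (excitable? Λ E) {xs = 𝔻 Λ} c∈))

  after-complete : ∀ {Λ μ D} → Excited Λ μ D →
                   ∃[ k ] rowSum D ≡ k + rowSum (initial Λ μ) × D ∈ after Λ μ k
  after-complete start = 0 , refl , here refl
  after-complete {Λ} {μ} (move {D} c e m) with after-complete e
  ... | k , eq , D∈ =
    suc k , trans (rowSum-excite c e m) (cong suc eq) ,
    ∈-concatMap⁺ (successors Λ)
      (lose D∈ (∈-map⁺ (excite Λ D) (∈-filter⁺ (excitable? Λ D) (excited-⊆ e (proj₁ m)) m)))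

excited? : ∀ Λ μ D → Dec (Excited Λ μ D)
excited? Λ μ D = map′ (after-sound Λ μ moves) complete (any? (≡-dec _≟ᶜ_ D) (after Λ μ moves))
  where
  moves = rowSum D ∸ rowSum (initial Λ μ)
  complete : Excited Λ μ D → D ∈ after Λ μ moves
  complete e with after-complete e
  ... | k , eq , D∈ =
    subst (λ n → D ∈ after Λ μ n)
          (sym (trans (cong (_∸ rowSum (initial Λ μ)) eq) (m+n∸n≡m k (rowSum (initial Λ μ))))) D∈

𝔼 : Partition → Partition → List (List Cell)
𝔼 Λ μ = filter (excited? Λ μ) (subsets (𝔻 Λ))

-- A finite set given by a list; only membership in the list matters.
record DescentSet : Set where
  field
    elements : List ℕ
    nonEmpty : elements ≢ []
    positive : All (0 <_) elements
open DescentSet public using (elements)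

RightOrAbove : Cell → Cell → Set
RightOrAbove c d = d ≡ right c ⊎ c ≡ below d

-- The cells from the lower-left end to the upper-right end.
IsRibbon : List Cell → Set
IsRibbon = Linked RightOrAbove

-- AscendsAt r i: the i-th cell of r, counting from 1, lies directly below the next one.
data AscendsAt : List Cell → ℕ → Set where
  here  : ∀ {c d r} → c ≡ below d → AscendsAt (c ∷ d ∷ r) 1
  there : ∀ {c r i} → AscendsAt r i → AscendsAt (c ∷ r) (suc i)

CorrespondsTo : List Cell → DescentSet → Set
CorrespondsTo r I = ∀ i → i ∈ elements I ⇔ AscendsAt r i

OnRim : Partition → Cell → Set
OnRim Λ c = c ∈ 𝔻 Λ × length (filter (_∈ᶜ? 𝔻 Λ) (right c ∷ below c ∷ diagonal c ∷ [])) < 3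

-- Λ = λ^I and μ = μ^I.
record IsShapeOf (I : DescentSet) (Λ μ : Partition) : Set where
  field
    ribbon      : List Cell
    isRibbon    : IsRibbon ribbon
    corresponds : CorrespondsTo ribbon I
    rim         : ∀ c → c ∈ ribbon ⇔ OnRim Λ c
    topRows     : part Λ 0 ≡ part Λ 1
    inner⊆outer : μ ⊆ᴾ Λ
    difference  : ∀ c → c ∈ ribbon ⇔ (c ∈ 𝔻 Λ × c ∉ 𝔻 μ)

-- The functions below take Λ = λ^I (and μ = μ^I) in place of I.

s : Partition → ℕ
s Λ = part Λ 0 ∸ 1

w : Partition → ℕ
w Λ = length (filter (λ j → conjugate Λ j ≟ 2) (upTo (suc (s Λ))))

inTopRow : List Cell → ℕ
inTopRow D = length (filter (λ c → proj₁ c ≟ 0) D)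

lowerHooks : Partition → List Cell → ℕ
lowerHooks Λ D = product (map (hook Λ) (filter (λ c → ¬? (proj₁ c ≟ 0)) D))

-- The coefficient C_j, for j ≤ s Λ.
C : Partition → Partition → ℕ → ℕ
C Λ μ j = sum (map (lowerHooks Λ) (filter (λ D → inTopRow D ≟ s Λ ∸ j) (𝔼 Λ μ)))

C/! : Partition → Partition → ℕ → ℚ
C/! Λ μ j = (+ C Λ μ j / j !) {{j !≢0}}

module Submission where

-- The cells of λ^I outside an excited diagram form a lattice path from the
-- bottom of column 1 to the end of row 1. If j + 1 of its cells lie in row 1,
-- it climbs into row 1 at column r = s + 1 - j. Let K(i,r) be the sum, over the
-- paths within the rows from i on that end at (i,r), of the products of the
-- hooks of the cells avoided in these rows. Then C_j = K(2,r), and splitting by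
-- the last step gives h(i,r) K(i,r) = K(i,r-1) + R_i K(i+1,r), where R_i is the
-- product of all hooks in row i and h(i,r) = (arm + 1) + leg.
-- The theorem is K(i,r-1) ≤ (arm + 1) K(i,r) for i = 2, where arm + 1 = j + 1.
-- By the recurrence this is equivalent to leg · K(i,r) ≤ R_i K(i+1,r), and it is
-- an equality if (i+1,r) is not a cell (r > 1). Otherwise it follows, strictly,
-- from the same bound at (i,r-1) and (i+1,r), since going left does not
-- decrease the leg and going down does not increase the arm.

open import Defs
open import Data.Empty using (⊥)
import Data.Integer as ℤ
import Data.Integer.Properties as ℤ
open import Data.List.Base
  using (List; []; _∷_; _++_; [_]; map; filter; length; upTo; applyUpTo; concatMap; cartesianProduct)
open import Data.List.Membership.Propositional using (_∈_; _∉_; find; lose)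
open import Data.List.Membership.Propositional.Properties
open import Data.List.Membership.Propositional.Properties.WithK using (unique∧set⇒bag)
open import Data.List.Properties hiding (sum-++)
open import Data.List.Relation.Binary.BagAndSetEquality using (∼bag⇒↭)
open import Data.List.Relation.Binary.Permutation.Propositional using (_↭_)
open import Data.List.Relation.Binary.Permutation.Propositional.Properties using (map⁺; ↭-length)
open import Data.List.Relation.Unary.All as All using (All; []; _∷_)
open import Data.List.Relation.Unary.Any using (here; there)
open import Data.List.Relation.Unary.AllPairs as AllPairs′ using ([]; _∷_)
import Data.List.Relation.Unary.AllPairs.Properties as AllPairs
open import Data.List.Relation.Unary.Linked using (Linked; []; [-]; _∷_)
open import Data.List.Relation.Unary.Unique.Propositional using (Unique)
import Data.List.Relation.Unary.Unique.Propositional.Properties as Unique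
open import Data.Nat.Base hiding (_>_)
open import Data.Nat.ListAction using (sum; product)
open import Data.Nat.ListAction.Properties using (sum-↭; sum-++; product-++)
open import Data.Nat.Properties
open import Data.Product.Base using (_×_; _,_; proj₁; proj₂; ∃-syntax; Σ-syntax)
open import Data.Rational.Base using (_>_)
import Data.Rational as ℚ
import Data.Rational.Properties as ℚ
import Data.Rational.Unnormalised as ℚᵘ
import Data.Rational.Unnormalised.Properties as ℚᵘ
open import Data.Sum.Base using (inj₁; inj₂)
open import Function.Base using (_∘_; id)
open import Function.Bundles using (_⇔_; mk⇔; Equivalence)
open import Relation.Binary.PropositionalEquality hiding ([_])
open import Relation.Nullary using (¬_; Dec; yes; no; contradiction)
open import Relation.Nullary.Decidable using (_×-dec_; ¬?; decidable-stable)
open import Relation.Unary using (Decidable)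

open Equivalence using (to; from)

-- Filters, subsets and enumerations without repetition.

filter-cong-∈ : {A : Set} {P Q : A → Set} (P? : Decidable P) (Q? : Decidable Q) (xs : List A) →
                (∀ {x} → x ∈ xs → P x ⇔ Q x) → filter P? xs ≡ filter Q? xs
filter-cong-∈ P? Q? []       eq = refl
filter-cong-∈ P? Q? (x ∷ xs) eq with P? x | Q? x
... | yes _ | yes _ = cong (x ∷_) (filter-cong-∈ P? Q? xs (eq ∘ there))
... | no  _ | no  _ = filter-cong-∈ P? Q? xs (eq ∘ there)
... | yes p | no ¬q = contradiction (to (eq (here refl)) p) ¬q
... | no ¬p | yes q = contradiction (from (eq (here refl)) q) ¬p

-- Allows a sum or a length to be computed from any other repetition-free enumeration of the same
-- set.
unique-↭ : {A : Set} {xs ys : List A} → Unique xs → Unique ys →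
           (∀ {x} → x ∈ xs ⇔ x ∈ ys) → xs ↭ ys
unique-↭ u v eq = ∼bag⇒↭ (unique∧set⇒bag u v eq)

unique-map : {A B : Set} (f : A → B) {xs : List A} → Unique xs →
             (∀ {x y} → x ∈ xs → y ∈ xs → f x ≡ f y → x ≡ y) → Unique (map f xs)
unique-map f []       inj = []
unique-map f (x≢ ∷ u) inj =
  All.tabulate (λ v∈ fx≡v → let y , y∈ , v≡fy = ∈-map⁻ f v∈ in
    All.lookup x≢ y∈ (inj (here refl) (there y∈) (trans fx≡v v≡fy)))
  ∷ unique-map f u (λ x∈ y∈ → inj (there x∈) (there y∈))

-- Complements of paths are filters of `𝔻 Λ`, so this places them among the candidates from which
-- `𝔼` selects.
filter-∈-subsets : {A : Set} {P : A → Set} (P? : Decidable P) (xs : List A) → filter P? xs ∈ subsets xs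
filter-∈-subsets P? []       = here refl
filter-∈-subsets P? (x ∷ xs) with P? x
... | yes _ = ∈-++⁺ˡ (∈-map⁺ (x ∷_) (filter-∈-subsets P? xs))
... | no  _ = ∈-++⁺ʳ _ (filter-∈-subsets P? xs)

subsets-⊆ : {A : Set} (xs : List A) {ys : List A} → ys ∈ subsets xs → ∀ {y} → y ∈ ys → y ∈ xs
subsets-⊆ []       (here refl) ()
subsets-⊆ (x ∷ xs) ys∈ y∈ with ∈-++⁻ (map (x ∷_) (subsets xs)) ys∈
... | inj₂ ys∈′ = there (subsets-⊆ xs ys∈′ y∈)
... | inj₁ ys∈′ with ∈-map⁻ (x ∷_) ys∈′ | y∈
...   | zs , zs∈ , refl | here y≡x = here y≡x
...   | zs , zs∈ , refl | there y∈′ = there (subsets-⊆ xs zs∈ y∈′)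

subsets-unique : {A : Set} {xs : List A} → Unique xs → Unique (subsets xs)
subsets-unique []       = [] ∷ []
subsets-unique {xs = x ∷ xs} (x≢ ∷ u) =
  Unique.++⁺ (Unique.map⁺ ∷-injectiveʳ (subsets-unique u)) (subsets-unique u) disjoint
  where
  disjoint : ∀ {zs} → ¬ (zs ∈ map (x ∷_) (subsets xs) × zs ∈ subsets xs)
  disjoint (p , q) with ∈-map⁻ (x ∷_) p
  ... | _ , _ , refl = All.lookup x≢ (subsets-⊆ xs q (here refl)) refl

-- Sequences of parts.

<pred⇒suc< : ∀ {j n} → j < pred n → suc j < n
<pred⇒suc< {n = suc n} lt = s<s lt

partAt-antitone : ∀ {ps} → Linked _≥_ ps → ∀ i → partAt ps (suc i) ≤ partAt ps i
partAt-antitone []        i       = z≤n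
partAt-antitone [-]       zero    = z≤n
partAt-antitone [-]       (suc i) = z≤n
partAt-antitone (p≥q ∷ l) zero    = p≥q
partAt-antitone (p≥q ∷ l) (suc i) = partAt-antitone l i

antitone⇒≥ : ∀ {f : ℕ → ℕ} → (∀ i → f (suc i) ≤ f i) → ∀ {i j} → i ≤ j → f j ≤ f i
antitone⇒≥ {f} anti {i} {j} i≤j = go (≤⇒≤′ i≤j)
  where
  go : ∀ {k} → i ≤′ k → f k ≤ f i
  go (≤′-reflexive refl) = ≤-refl
  go (≤′-step p) = ≤-trans (anti _) (go p)

partAt-<-length : ∀ ps {i j} → j < partAt ps i → i < length ps
partAt-<-length []       ()
partAt-<-length (p ∷ ps) {zero}  lt = z<s
partAt-<-length (p ∷ ps) {suc i} lt = s<s (partAt-<-length ps lt)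

partAt-positive : ∀ {ps} → All (0 <_) ps → ∀ {i} → i < length ps → 0 < partAt ps i
partAt-positive (p ∷ _) {zero}  _        = p
partAt-positive (_ ∷ a) {suc i} (s<s lt) = partAt-positive a lt

partAt-applyUpTo : ∀ (f : ℕ → ℕ) n {k} → (n ≤ k → f k ≡ 0) → partAt (applyUpTo f n) k ≡ f k
partAt-applyUpTo f zero    z = sym (z z≤n)
partAt-applyUpTo f (suc n) {zero}  z = refl
partAt-applyUpTo f (suc n) {suc k} z = partAt-applyUpTo (f ∘ suc) n (z ∘ s≤s)

partAt-ext : ∀ {as bs} → length as ≡ length bs → partAt as ≗ partAt bs → as ≡ bs
partAt-ext {[]}     {[]}     _  _  = refl
partAt-ext {a ∷ as} {b ∷ bs} l≡ eq = cong₂ _∷_ (eq 0) (partAt-ext (suc-injective l≡) (eq ∘ suc))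

-- Conditional factors, sums and products.

factor : {P : Set} → Dec P → ℕ → ℕ
factor (yes _) v = v
factor (no _)  v = 1

factor-1 : {P : Set} (P? : Dec P) → factor P? 1 ≡ 1
factor-1 (yes _) = refl
factor-1 (no _)  = refl

factor-cong : {P Q : Set} (P? : Dec P) (Q? : Dec Q) → P ⇔ Q → ∀ v → factor P? v ≡ factor Q? v
factor-cong (yes p) (yes q) eq v = refl
factor-cong (no ¬p) (no ¬q) eq v = refl
factor-cong (yes p) (no ¬q) eq v = contradiction (to eq p) ¬q
factor-cong (no ¬p) (yes q) eq v = contradiction (from eq q) ¬p

factor-× : {P Q : Set} (P? : Dec P) (Q? : Dec Q) (v : ℕ) → factor P? (factor Q? v) ≡ factor (P? ×-dec Q?) v
factor-× (yes _) (yes _) v = refl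
factor-× (yes _) (no _)  v = refl
factor-× (no _)  (yes _) v = refl
factor-× (no _)  (no _)  v = refl

-- Replacing a filter by factors equal to 1 makes the index set independent of the condition, so
-- that products for different paths can be compared factor by factor.
product-filter : {A : Set} {P : A → Set} (P? : Decidable P) (g : A → ℕ) (xs : List A) →
                 product (map g (filter P? xs)) ≡ product (map (λ x → factor (P? x) (g x)) xs)
product-filter P? g []       = refl
product-filter P? g (x ∷ xs) with P? x
... | yes _ = cong (g x *_) (product-filter P? g xs)
... | no  _ = trans (product-filter P? g xs) (sym (*-identityˡ _))

product-cartesian : {A B : Set} (g : A × B → ℕ) (xs : List A) (ys : List B) →
                    product (map g (cartesianProduct xs ys)) ≡
                    product (map (λ x → product (map (λ y → g (x , y)) ys)) xs)
product-cartesian g []       ys = refl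
product-cartesian g (x ∷ xs) ys = begin
  product (map g (map (x ,_) ys ++ cartesianProduct xs ys))
    ≡⟨ cong product (map-++ g (map (x ,_) ys) _) ⟩
  product (map g (map (x ,_) ys) ++ map g (cartesianProduct xs ys))
    ≡⟨ product-++ (map g (map (x ,_) ys)) _ ⟩
  product (map g (map (x ,_) ys)) * product (map g (cartesianProduct xs ys))
    ≡⟨ cong₂ _*_ (cong product (sym (map-∘ ys))) (product-cartesian g xs ys) ⟩
  product (map (λ y → g (x , y)) ys) * product (map (λ x → product (map (λ y → g (x , y)) ys)) xs) ∎
  where open ≡-Reasoning

product-ones : {A : Set} {g : A → ℕ} → (∀ x → g x ≡ 1) → (xs : List A) → product (map g xs) ≡ 1
product-ones eq []       = refl
product-ones eq (x ∷ xs) = cong₂ _*_ (eq x) (product-ones eq xs)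

sum-concatMap : {A B : Set} (g : B → ℕ) (h : A → List B) (xs : List A) →
                sum (map g (concatMap h xs)) ≡ sum (map (λ x → sum (map g (h x))) xs)
sum-concatMap g h []       = refl
sum-concatMap g h (x ∷ xs) = trans (cong sum (map-++ g (h x) (concatMap h xs)))
  (trans (sum-++ (map g (h x)) _) (cong (sum (map g (h x)) +_) (sum-concatMap g h xs)))

sum-map-* : {A : Set} (c : ℕ) (g : A → ℕ) (xs : List A) → sum (map (λ x → c * g x) xs) ≡ c * sum (map g xs)
sum-map-* c g []       = sym (*-zeroʳ c)
sum-map-* c g (x ∷ xs) = trans (cong (c * g x +_) (sum-map-* c g xs)) (sym (*-distribˡ-+ c (g x) _))

map-cong-∈ : {A B : Set} {f g : A → B} (xs : List A) → (∀ {x} → x ∈ xs → f x ≡ g x) → map f xs ≡ map g xs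
map-cong-∈ xs eq = map-cong-local (All.tabulate eq)

sum-upTo-suc : (g : ℕ → ℕ) (m : ℕ) → sum (map g (upTo (suc m))) ≡ sum (map g (upTo m)) + g m
sum-upTo-suc g m = begin
  sum (map g (upTo (suc m)))             ≡⟨ cong (sum ∘ map g) (upTo-∷ʳ m) ⟨
  sum (map g (upTo m ++ m ∷ []))         ≡⟨ cong sum (map-++ g (upTo m) _) ⟩
  sum (map g (upTo m) ++ g m ∷ [])       ≡⟨ sum-++ (map g (upTo m)) _ ⟩
  sum (map g (upTo m)) + (g m + 0)       ≡⟨ cong (sum (map g (upTo m)) +_) (+-identityʳ (g m)) ⟩
  sum (map g (upTo m)) + g m             ∎
  where open ≡-Reasoning

product-upTo-suc : (g : ℕ → ℕ) (m : ℕ) → product (map g (upTo (suc m))) ≡ product (map g (upTo m)) * g m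
product-upTo-suc g m = begin
  product (map g (upTo (suc m)))         ≡⟨ cong (product ∘ map g) (upTo-∷ʳ m) ⟨
  product (map g (upTo m ++ m ∷ []))     ≡⟨ cong product (map-++ g (upTo m) _) ⟩
  product (map g (upTo m) ++ g m ∷ [])   ≡⟨ product-++ (map g (upTo m)) _ ⟩
  product (map g (upTo m)) * (g m * 1)   ≡⟨ cong (product (map g (upTo m)) *_) (*-identityʳ (g m)) ⟩
  product (map g (upTo m)) * g m         ∎
  where open ≡-Reasoning

-- The factor at e, which is 1 under f, is put back; all others agree. This is how a row product
-- changes when a path loses one cell of the row.
product-update : ∀ {f g : ℕ → ℕ} {e m} → e < m → (∀ {j} → j ≢ e → f j ≡ g j) → f e ≡ 1 →
                 g e * product (map f (upTo m)) ≡ product (map g (upTo m))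
product-update {f} {g} {e} {suc m} e<m f≗g fe with e ≟ m
... | yes refl = begin
  g e * product (map f (upTo (suc e)))      ≡⟨ cong (g e *_) (product-upTo-suc f e) ⟩
  g e * (product (map f (upTo e)) * f e)    ≡⟨ cong (λ v → g e * (product (map f (upTo e)) * v)) fe ⟩
  g e * (product (map f (upTo e)) * 1)      ≡⟨ cong (g e *_) (*-identityʳ _) ⟩
  g e * product (map f (upTo e))            ≡⟨ cong (λ xs → g e * product xs) (map-cong-∈ (upTo e) (f≗g ∘ <⇒≢ ∘ ∈-upTo⁻)) ⟩
  g e * product (map g (upTo e))            ≡⟨ *-comm (g e) _ ⟩
  product (map g (upTo e)) * g e            ≡⟨ product-upTo-suc g e ⟨
  product (map g (upTo (suc e)))            ∎
  where open ≡-Reasoning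
... | no e≢m = begin
  g e * product (map f (upTo (suc m)))      ≡⟨ cong (g e *_) (product-upTo-suc f m) ⟩
  g e * (product (map f (upTo m)) * f m)    ≡⟨ *-assoc (g e) _ _ ⟨
  g e * product (map f (upTo m)) * f m      ≡⟨ cong₂ _*_ (product-update (≤∧≢⇒< (s≤s⁻¹ e<m) e≢m) f≗g fe) (f≗g (e≢m ∘ sym)) ⟩
  product (map g (upTo m)) * g m            ≡⟨ product-upTo-suc g m ⟨
  product (map g (upTo (suc m)))            ∎
  where open ≡-Reasoning

product-positive : {g : ℕ → ℕ} → (∀ j → 0 < g j) → (xs : List ℕ) → 0 < product (map g xs)
product-positive pos []       = z<s
product-positive pos (x ∷ xs) = *-mono-< (pos x) (product-positive pos xs)

factor-positive : {P : Set} (P? : Dec P) {v : ℕ} → (P → 0 < v) → 0 < factor P? v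
factor-positive (yes p) pos = pos p
factor-positive (no _)  pos = z<s

length-filter-⊆ : {A : Set} {P Q : A → Set} (P? : Decidable P) (Q? : Decidable Q) → (∀ {x} → P x → Q x) →
                  (xs : List A) → length (filter P? xs) ≤ length (filter Q? xs)
length-filter-⊆ P? Q? P⊆Q []       = z≤n
length-filter-⊆ P? Q? P⊆Q (x ∷ xs) with P? x | Q? x
... | yes _ | yes _ = s≤s (length-filter-⊆ P? Q? P⊆Q xs)
... | yes p | no ¬q = contradiction (P⊆Q p) ¬q
... | no _  | yes _ = m≤n⇒m≤1+n (length-filter-⊆ P? Q? P⊆Q xs)
... | no _  | no _  = length-filter-⊆ P? Q? P⊆Q xs

length-filter-≥ : ∀ j n → length (filter (j ≤?_) (upTo n)) ≡ n ∸ j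
length-filter-≥ j zero = sym (0∸n≡0 j)
length-filter-≥ j (suc n) = begin
  length (filter (j ≤?_) (upTo (suc n)))
    ≡⟨ cong (length ∘ filter (j ≤?_)) (upTo-∷ʳ n) ⟨
  length (filter (j ≤?_) (upTo n ++ n ∷ []))
    ≡⟨ cong length (filter-++ (j ≤?_) (upTo n) (n ∷ [])) ⟩
  length (filter (j ≤?_) (upTo n) ++ filter (j ≤?_) (n ∷ []))
    ≡⟨ length-++ (filter (j ≤?_) (upTo n)) ⟩
  length (filter (j ≤?_) (upTo n)) + length (filter (j ≤?_) (n ∷ []))
    ≡⟨ cong (_+ length (filter (j ≤?_) (n ∷ []))) (length-filter-≥ j n) ⟩
  n ∸ j + length (filter (j ≤?_) (n ∷ []))
    ≡⟨ last ⟩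
  suc n ∸ j ∎
  where
  open ≡-Reasoning
  last : n ∸ j + length (filter (j ≤?_) (n ∷ [])) ≡ suc n ∸ j
  last with ≤-<-connex j n
  ... | inj₁ j≤n = trans (cong (λ xs → n ∸ j + length xs) (filter-accept (j ≤?_) j≤n))
        (trans (+-comm (n ∸ j) 1) (sym (+-∸-assoc 1 j≤n)))
  ... | inj₂ n<j = trans (cong (λ xs → n ∸ j + length xs) (filter-reject (j ≤?_) (<⇒≱ n<j)))
        (trans (+-identityʳ (n ∸ j)) (trans (m≤n⇒m∸n≡0 (<⇒≤ n<j)) (sym (m≤n⇒m∸n≡0 n<j))))

-- The column just after the end of a path in the k-th of its rows: e in the first row, afterwards
-- one more than the left end in the row above, since the path climbs there.
tailEnd : ℕ → List ℕ → ℕ → ℕ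
tailEnd e as zero    = e
tailEnd e as (suc k) = suc (partAt as k)

-- The cells of a Young diagram.

module Diagram (Λ : Partition) where

  L = length (parts Λ)

  part-antitone : ∀ i → part Λ (suc i) ≤ part Λ i
  part-antitone = partAt-antitone (decreasing Λ)

  part-≥ : ∀ {i j} → i ≤ j → part Λ j ≤ part Λ i
  part-≥ = antitone⇒≥ part-antitone

  part-zero : ∀ {i} → L ≤ i → part Λ i ≡ 0
  part-zero {i} L≤i with part Λ i in eq
  ... | zero  = refl
  ... | suc p = contradiction (partAt-<-length (parts Λ) {i} (subst (0 <_) (sym eq) z<s)) (≤⇒≯ L≤i)

  ∈𝔻⁺ : ∀ {i j} → j < part Λ i → (i , j) ∈ 𝔻 Λ
  ∈𝔻⁺ {i} lt = ∈-filter⁺ (inRow? Λ)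
    (∈-cartesianProduct⁺ (∈-upTo⁺ (partAt-<-length (parts Λ) lt)) (∈-upTo⁺ (<-≤-trans lt (part-≥ z≤n)))) lt

  ∈𝔻⁻ : ∀ {i j} → (i , j) ∈ 𝔻 Λ → j < part Λ i
  ∈𝔻⁻ c∈ = proj₂ (∈-filter⁻ (inRow? Λ) {xs = cartesianProduct (upTo L) (upTo (part Λ 0))} c∈)

  -- Lattice paths and their complements.

  end : (ℕ → ℕ) → ℕ → ℕ
  end f zero    = part Λ 0
  end f (suc i) = suc (f i)

  OnPath : (ℕ → ℕ) → Cell → Set
  OnPath f (i , j) = f i ≤ j × j < end f i

  onPath? : ∀ f c → Dec (OnPath f c)
  onPath? f (i , j) = (f i ≤? j) ×-dec (j <? end f i)

  offPath : (ℕ → ℕ) → List Cell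
  offPath f = filter (λ c → ¬? (onPath? f c)) (𝔻 Λ)

  -- f i is the first column of the path in row i; in the last row it is 0 by
  -- pred 0 = 0. OnPath f c says that c lies on the path, which in row i + 1 ends
  -- where it starts in row i.
  record Profile (f : ℕ → ℕ) : Set where
    field
      antitone : ∀ i → f (suc i) ≤ f i
      bounded  : ∀ i → f i ≤ pred (part Λ (suc i))
  open Profile

  ∈offPath⁺ : ∀ f {c} → c ∈ 𝔻 Λ → ¬ OnPath f c → c ∈ offPath f
  ∈offPath⁺ f = ∈-filter⁺ (λ c → ¬? (onPath? f c))

  ∈offPath⁻ : ∀ f {c} → c ∈ offPath f → c ∈ 𝔻 Λ × ¬ OnPath f c
  ∈offPath⁻ f = ∈-filter⁻ (λ c → ¬? (onPath? f c)) {xs = 𝔻 Λ}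

  ∉offPath⇒OnPath : ∀ f {c} → c ∈ 𝔻 Λ → c ∉ offPath f → OnPath f c
  ∉offPath⇒OnPath f {c} c∈ c∉ = decidable-stable (onPath? f c) (c∉ ∘ ∈offPath⁺ f c∈)

  end-cong : ∀ {f g} → f ≗ g → ∀ i → end f i ≡ end g i
  end-cong eq zero    = refl
  end-cong eq (suc i) = cong suc (eq i)

  offPath-cong : ∀ {f g} → f ≗ g → offPath f ≡ offPath g
  offPath-cong {f} {g} eq = filter-cong-∈ _ _ (𝔻 Λ) λ {(i , j)} _ → mk⇔
    (λ off (p , q) → off (subst (_≤ j) (sym (eq i)) p , subst (j <_) (sym (end-cong eq i)) q))
    (λ off (p , q) → off (subst (_≤ j) (eq i) p , subst (j <_) (end-cong eq i) q))

  -- The paths of f and g differ in one corner: that of f passes through the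
  -- three neighbours of (i , j), that of g through (i , j) instead of (i + 1 , j + 1).
  excite-offPath : ∀ {f g i j} → f i ≡ suc j → g i ≡ j → (∀ {k} → k ≢ i → g k ≡ f k) →
                   f (suc i) ≤ j → j < end f i →
                   excite Λ (offPath f) (i , j) ≡ offPath g
  excite-offPath {f} {g} {i} {j} fi gi g≗f f≤j j<e =
    filter-cong-∈ _ _ (𝔻 Λ) λ {c} c∈ → mk⇔ (fwd c c∈) (bwd c c∈)
    where
    end-≡ : ∀ {k} → k ≢ suc i → end g k ≡ end f k
    end-≡ {zero}  _  = refl
    end-≡ {suc k} ne = cong suc (g≗f (ne ∘ cong suc))
    g[1+i] = g≗f {suc i} 1+n≢n
    new = λ x → x ∈ diagonal (i , j) ∷ offPath f × x ≢ (i , j)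
    fwd : ∀ c → c ∈ 𝔻 Λ → new c → ¬ OnPath g c
    fwd (k , l) c∈ (here refl , ne) (p , q) rewrite gi = contradiction q (<-irrefl refl)
    fwd (k , l) c∈ (there x∈ , ne) (p , q) with proj₂ (∈offPath⁻ f x∈) | k ≟ i | k ≟ suc i
    ... | off | yes refl | _ = off
          ( subst (_≤ l) (sym fi) (≤∧≢⇒< (subst (_≤ l) gi p) (λ j≡l → ne (cong (k ,_) (sym j≡l))))
          , subst (l <_) (end-≡ (1+n≢n ∘ sym)) q)
    ... | off | no _ | yes refl = off
          (subst (_≤ l) g[1+i] p , subst (l <_) (cong suc (sym fi)) (m≤n⇒m≤1+n (subst (l <_) (cong suc gi) q)))
    ... | off | no k≢i | no k≢1+i = off (subst (_≤ l) (g≗f k≢i) p , subst (l <_) (end-≡ k≢1+i) q)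
    bwd : ∀ c → c ∈ 𝔻 Λ → ¬ OnPath g c → new c
    bwd (k , l) c∈ off with k ≟ i | k ≟ suc i
    ... | yes refl | _ =
          there (∈offPath⁺ f c∈ λ (p , q) → off
            (subst (_≤ l) (sym gi) (<⇒≤ (subst (_≤ l) fi p)) , subst (l <_) (sym (end-≡ (1+n≢n ∘ sym))) q))
          , λ { refl → off (≤-reflexive gi , subst (j <_) (sym (end-≡ (1+n≢n ∘ sym))) j<e) }
    ... | no k≢i | no k≢1+i =
          there (∈offPath⁺ f c∈ λ (p , q) → off
            (subst (_≤ l) (sym (g≗f k≢i)) p , subst (l <_) (sym (end-≡ k≢1+i)) q))
          , k≢i ∘ cong proj₁
    ... | no k≢i | yes refl with l ≟ suc j
    ...   | yes refl = here refl , k≢i ∘ cong proj₁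
    ...   | no l≢ =
          there (∈offPath⁺ f c∈ λ (p , q) → off
            (subst (_≤ l) (sym g[1+i]) p ,
             subst (l <_) (cong suc (sym gi)) (≤∧≢⇒< (s≤s⁻¹ (subst (l <_) (cong suc fi) q)) l≢)))
          , k≢i ∘ cong proj₁

  -- The largest profile. Its path runs along the rim: it leaves row i + 1 at the last cell of that
  -- row.
  rim-profile : ℕ → ℕ
  rim-profile i = pred (part Λ (suc i))

  rim-profile-Profile : Profile rim-profile
  rim-profile-Profile = record { antitone = λ i → pred-mono-≤ (part-antitone (suc i)) ; bounded = λ _ → ≤-refl }

  rim-profile-end : ∀ {i j} → j < part Λ i → j < end rim-profile i
  rim-profile-end {zero}  lt = lt
  rim-profile-end {suc i} {j} lt with part Λ (suc i)
  ... | suc _ = lt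

  Profile-<end : ∀ {f} → Profile f → ∀ {i j} → j < f i → j < pred (end f i)
  Profile-<end {f} P {zero} lt = <-≤-trans lt (≤-trans (bounded P 0) (pred-mono-≤ (part-antitone 0)))
  Profile-<end {f} P {suc i} lt = <-≤-trans lt (antitone P i)

  Profile-cell : ∀ {f} → Profile f → ∀ {i j} → j < f i → j < part Λ i
  Profile-cell P {i} lt = <-≤-trans (<⇒≤ (<pred⇒suc< (<-≤-trans lt (bounded P i)))) (part-antitone i)

  -- Induction down the rows: once the profiles agree in the row above, both paths end in the same
  -- column of row i. If one of them started further left, its first cell there would be off the
  -- other path.
  offPath-injective : ∀ {f g} → Profile f → Profile g → offPath f ≡ offPath g → f ≗ g
  offPath-injective {f} {g} Pf Pg eq i = ≤-antisym
    (≮⇒≥ (not-below Pf Pg eq i (ends i)))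
    (≮⇒≥ (not-below Pg Pf (sym eq) i (sym (ends i))))
    where
    not-below : ∀ {f g} → Profile f → Profile g → offPath f ≡ offPath g → ∀ i → end f i ≡ end g i → ¬ (g i < f i)
    not-below {f} {g} Pf Pg eq i e≡ lt = proj₂ (∈offPath⁻ g (subst ((i , g i) ∈_) eq f∋)) (≤-refl , gi<end)
      where
      f∋ : (i , g i) ∈ offPath f
      f∋ = ∈offPath⁺ f (∈𝔻⁺ (Profile-cell Pf lt)) λ (p , _) → <⇒≱ lt p
      gi<end = subst (g i <_) e≡ (<⇒≤ (<pred⇒suc< (Profile-<end Pf {i} lt)))
    ends : ∀ i → end f i ≡ end g i
    ends zero    = refl
    ends (suc i) = cong suc (offPath-injective Pf Pg eq i)

  -- Excited diagrams are the complements of paths.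

  module ExcitedProfiles (μ : Partition) (inner : ∀ {c} → c ∈ 𝔻 Λ → c ∈ 𝔻 μ ⇔ diagonal c ∈ 𝔻 Λ) where

    -- A cell (i , j) is off the rim path when j + 1 < `part Λ (suc i)`, that is, when its diagonal
    -- neighbour is in Λ; by `inner` these are the cells of μ.
    initial≡offPath : initial Λ μ ≡ offPath rim-profile
    initial≡offPath = filter-cong-∈ _ _ (𝔻 Λ) λ {c} c∈ → mk⇔
      (λ c∈μ (p , _) → <⇒≱ (∈𝔻⁻ (to (inner c∈) c∈μ)) (≤pred⇒ p))
      (λ off → from (inner c∈) (∈𝔻⁺ (≰⇒> λ le → off (pred-mono-≤ le , rim-profile-end (∈𝔻⁻ c∈)))))
      where
      ≤pred⇒ : ∀ {m n} → pred m ≤ n → m ≤ suc n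
      ≤pred⇒ {zero}  _ = z≤n
      ≤pred⇒ {suc m} p = s≤s p

    -- For a move at (i , j) the three neighbours lie on the path while (i , j) does not. This
    -- forces `f i` to be j + 1 and leaves room to lower it to j.
    excited⇒profile : ∀ {D} → Excited Λ μ D → Σ[ f ∈ (ℕ → ℕ) ] Profile f × D ≡ offPath f
    excited⇒profile start = rim-profile , rim-profile-Profile , initial≡offPath
    excited⇒profile (move (i , j) e (c∈D , d∈Λ , r∉D , b∉D , d∉D)) with excited⇒profile e
    ... | f , P , refl = g , Pg , excite-offPath fi gi g≗f f≤j (<⇒≤ (proj₂ right-on))
      where
      right-on : OnPath f (i , suc j)
      right-on = ∉offPath⇒OnPath f (∈𝔻⁺ (<-≤-trans (∈𝔻⁻ d∈Λ) (part-antitone i))) r∉D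
      f≤j : f (suc i) ≤ j
      f≤j = proj₁ (∉offPath⇒OnPath f (∈𝔻⁺ (<⇒≤ (∈𝔻⁻ d∈Λ))) b∉D)
      fi : f i ≡ suc j
      fi = ≤-antisym (proj₁ right-on)
             (≰⇒> λ fi≤j → proj₂ (∈offPath⁻ f c∈D) (fi≤j , <⇒≤ (proj₂ right-on)))
      g : ℕ → ℕ
      g k with k ≟ i
      ... | yes _ = j
      ... | no  _ = f k
      gi : g i ≡ j
      gi with i ≟ i
      ... | yes _ = refl
      ... | no ne = contradiction refl ne
      g≗f : ∀ {k} → k ≢ i → g k ≡ f k
      g≗f {k} ne with k ≟ i
      ... | yes eq = contradiction eq ne
      ... | no _ = refl
      g≤f : ∀ k → g k ≤ f k
      g≤f k with k ≟ i
      ... | yes refl = <⇒≤ (≤-reflexive (sym fi))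
      ... | no _ = ≤-refl
      Pg : Profile g
      Pg .bounded k = ≤-trans (g≤f k) (bounded P k)
      Pg .antitone k with k ≟ i
      ... | no _ = ≤-trans (g≤f (suc k)) (antitone P k)
      ... | yes refl = ≤-trans (≤-reflexive (g≗f 1+n≢n)) f≤j

    -- The rows are raised to the rim one after another from the top, m of them being left. With
    -- none left, `f` is the rim profile, whose complement is the start.
    profile⇒excited : ∀ m k {f} → m + k ≡ L → Profile f → (∀ {i} → i < k → f i ≡ rim-profile i) →
                      Excited Λ μ (offPath f)
    -- Once the rows above k are maximal, raising f k by one keeps f antitone and
    -- is undone by a single move, at (k , f k).
    raise : ∀ m d k {f} → m + suc k ≡ L → Profile f → (∀ {i} → i < k → f i ≡ rim-profile i) →
            d + f k ≡ rim-profile k → Excited Λ μ (offPath f)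

    profile⇒excited zero k {f} refl P agree = subst (Excited Λ μ) (trans initial≡offPath (offPath-cong (sym ∘ f≗))) start
      where
      f≗ : f ≗ rim-profile
      f≗ i with i <? L
      ... | yes i<L = agree i<L
      ... | no  i≮L = ≤-antisym (bounded P i) (subst (_≤ f i) (cong pred (sym (part-zero (m≤n⇒m≤1+n (≮⇒≥ i≮L))))) z≤n)
    profile⇒excited (suc m) k {f} eq P agree =
      raise m (rim-profile k ∸ f k) k (trans (+-suc m k) eq) P agree (m∸n+n≡m (bounded P k))

    raise m zero k {f} eq P agree full = profile⇒excited m (suc k) eq P agree′
      where
      agree′ : ∀ {i} → i < suc k → f i ≡ rim-profile i
      agree′ {i} (s≤s i≤k) with i ≟ k
      ... | yes refl = full
      ... | no  ne   = agree (≤∧≢⇒< i≤k ne)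
    raise m (suc d) k {f} eq P agree full =
      subst (Excited Λ μ) (excite-offPath gk refl (sym ∘ g≗f) g≤ (<⇒≤ k<e)) (move (k , f k) eg
        ( ∈offPath⁺ g (∈𝔻⁺ (Profile-cell Pg fk<gk)) (λ (p , _) → <⇒≱ fk<gk p)
        , ∈𝔻⁺ (<pred⇒suc< (<-≤-trans fk<gk (bounded Pg k)))
        , on (≤-reflexive gk , k<e)
        , on (g≤ , s≤s (<⇒≤ fk<gk))
        , on (m≤n⇒m≤1+n g≤ , s≤s fk<gk)))
      where
      g : ℕ → ℕ
      g i with i ≟ k
      ... | yes _ = suc (f k)
      ... | no  _ = f i
      gk : g k ≡ suc (f k)
      gk with k ≟ k
      ... | yes _ = refl
      ... | no ne = contradiction refl ne
      g≗f : ∀ {i} → i ≢ k → g i ≡ f i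
      g≗f {i} ne with i ≟ k
      ... | yes i≡k = contradiction i≡k ne
      ... | no _ = refl
      fk<gk = ≤-reflexive (sym gk)
      g≤ : g (suc k) ≤ f k
      g≤ = ≤-trans (≤-reflexive (g≗f 1+n≢n)) (antitone P k)
      fk<rim : suc (f k) ≤ rim-profile k
      fk<rim = ≤-trans (s≤s (m≤n+m (f k) d)) (≤-reflexive full)
      f≤g : ∀ i → f i ≤ g i
      f≤g i with i ≟ k
      ... | yes refl = n≤1+n _
      ... | no _ = ≤-refl
      Pg : Profile g
      Pg .bounded i with i ≟ k
      ... | yes refl = fk<rim
      ... | no _ = bounded P i
      Pg .antitone i with suc i ≟ k
      ... | no  _ = ≤-trans (antitone P i) (f≤g i)
      ... | yes refl = ≤-trans fk<rim (≤-trans (antitone rim-profile-Profile i)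
                         (≤-trans (≤-reflexive (sym (agree ≤-refl))) (f≤g i)))
      k<e : suc (f k) < end g k
      k<e = <pred⇒suc< (Profile-<end Pg {k} fk<gk)
      on : ∀ {c} → OnPath g c → c ∉ offPath g
      on p c∈ = proj₂ (∈offPath⁻ g c∈) p
      eg : Excited Λ μ (offPath g)
      eg = raise m d k eq Pg (λ i<k → trans (g≗f (<⇒≢ i<k)) (agree i<k))
             (trans (cong (d +_) gk) (trans (+-suc d (f k)) full))

  -- Enumeration of the paths.

  inTopRow-offPath : ∀ {f} → Profile f → inTopRow (offPath f) ≡ f 0
  inTopRow-offPath {f} P = trans (↭-length (unique-↭
      (Unique.filter⁺ _ (Unique.filter⁺ _ (𝔻-unique Λ)))
      (Unique.map⁺ (cong proj₂) (Unique.upTo⁺ (f 0)))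
      (mk⇔ fwd bwd)))
    (trans (length-map {B = Cell} (0 ,_) (upTo (f 0))) (length-upTo (f 0)))
    where
    fwd : ∀ {c} → c ∈ filter (λ c → proj₁ c ≟ 0) (offPath f) → c ∈ map (0 ,_) (upTo (f 0))
    fwd {c} c∈ with ∈-filter⁻ (λ c → proj₁ c ≟ 0) {xs = offPath f} c∈
    ... | c∈′ , refl with ∈offPath⁻ f c∈′
    ...   | c∈Λ , off = ∈-map⁺ (0 ,_) (∈-upTo⁺ (≰⇒> λ le → off (le , ∈𝔻⁻ c∈Λ)))
    bwd : ∀ {c} → c ∈ map (0 ,_) (upTo (f 0)) → c ∈ filter (λ c → proj₁ c ≟ 0) (offPath f)
    bwd c∈ with ∈-map⁻ (0 ,_) c∈
    ... | j , j∈ , refl = ∈-filter⁺ (λ c → proj₁ c ≟ 0)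
          (∈offPath⁺ f (∈𝔻⁺ (Profile-cell P (∈-upTo⁻ j∈))) (λ (p , _) → <⇒≱ (∈-upTo⁻ j∈) p)) refl

  -- The possible left ends, in the n rows below row i, of a path whose part in
  -- row i ends just before column e.
  tails : ℕ → ℕ → ℕ → List (List ℕ)
  tails zero    i zero    = []
  tails zero    i (suc _) = [ [] ]
  tails (suc n) i e       = concatMap (λ a → map (a ∷_) (tails n (suc i) (suc a))) (upTo (e ⊓ part Λ (suc i)))

  ∈tails⁺ : ∀ {n i e a as} → a < e → a < part Λ (suc i) → as ∈ tails n (suc i) (suc a) → a ∷ as ∈ tails (suc n) i e
  ∈tails⁺ {n} {i} {e} {a} lt₁ lt₂ as∈ =
    ∈-concatMap⁺ _ {xs = upTo (e ⊓ part Λ (suc i))} (lose (∈-upTo⁺ (⊓-glb lt₁ lt₂)) (∈-map⁺ (a ∷_) as∈))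

  data TailView (n i e : ℕ) : List ℕ → Set where
    cons : ∀ {a as} → a < e → a < part Λ (suc i) → as ∈ tails n (suc i) (suc a) → TailView n i e (a ∷ as)

  ∈tails⁻ : ∀ n i e {as} → as ∈ tails (suc n) i e → TailView n i e as
  ∈tails⁻ n i e as∈ with find (∈-concatMap⁻ _ {xs = upTo (e ⊓ part Λ (suc i))} as∈)
  ... | a , a∈ , as∈′ with ∈-map⁻ (a ∷_) as∈′
  ...   | _ , as∈″ , refl = cons (≤-trans (∈-upTo⁻ a∈) (m⊓n≤m e _)) (≤-trans (∈-upTo⁻ a∈) (m⊓n≤n e _)) as∈″

  tails-length : ∀ n {i e as} → as ∈ tails n i e → length as ≡ n
  tails-length zero {e = suc _} (here refl) = refl
  tails-length (suc n) {i} {e} as∈ with ∈tails⁻ n i e as∈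
  ... | cons _ _ as∈′ = cong suc (tails-length n as∈′)

  tails-antitone : ∀ n {i b as} → as ∈ tails n i (suc b) → ∀ k → partAt as k ≤ partAt (b ∷ as) k
  tails-antitone zero (here refl) k = z≤n
  tails-antitone (suc n) {i} {b} as∈ k with ∈tails⁻ n i (suc b) as∈
  tails-antitone (suc n) as∈ zero    | cons a<e _ _ = s≤s⁻¹ a<e
  tails-antitone (suc n) as∈ (suc k) | cons _ _ as∈′ = tails-antitone n as∈′ k

  tails-bounded : ∀ n {i e as} → as ∈ tails n i e → ∀ k → partAt as k ≤ pred (part Λ (suc (k + i)))
  tails-bounded zero {e = suc _} (here refl) k = z≤n
  tails-bounded (suc n) {i} {e} as∈ k with ∈tails⁻ n i e as∈
  tails-bounded (suc n) as∈ zero    | cons _ a<p _ = pred-mono-≤ a<p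
  tails-bounded (suc n) {i} as∈ (suc k) | cons {as = as} _ _ as∈′ =
    subst (λ m → partAt as k ≤ pred (part Λ (suc m))) (+-suc k i) (tails-bounded n as∈′ k)

  tails-unique : ∀ n i e → Unique (tails n i e)
  tails-unique zero    i zero    = []
  tails-unique zero    i (suc e) = [] ∷ []
  tails-unique (suc n) i e = Unique.concat⁺
    (All.tabulate λ x∈ → unique-each (∈-map⁻ _ x∈))
    (AllPairs.map⁺ (AllPairs′.map (λ a≢b {x} (p , q) → disjoint a≢b p q) (Unique.upTo⁺ _)))
    where
    unique-each : ∀ {xs} → ∃[ a ] a ∈ upTo (e ⊓ part Λ (suc i)) × xs ≡ map (a ∷_) (tails n (suc i) (suc a)) → Unique xs
    unique-each (a , _ , refl) = Unique.map⁺ ∷-injectiveʳ (tails-unique n (suc i) (suc a))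
    disjoint : ∀ {a b x xs ys} → a ≢ b → x ∈ map (a ∷_) xs → x ∈ map (b ∷_) ys → ⊥
    disjoint a≢b p q with ∈-map⁻ _ p | ∈-map⁻ _ q
    ... | _ , _ , refl | _ , _ , refl = a≢b refl

  -- The converse of `tails-antitone` and `tails-bounded`: every weakly decreasing sequence within
  -- the bounds is listed, so `tails` misses no path.
  applyUpTo∈tails : ∀ n {i e} {g : ℕ → ℕ} → (∀ k → g (suc k) ≤ g k) →
                    (∀ {k} → k < n → g k < part Λ (suc (k + i))) → g 0 < e → applyUpTo g n ∈ tails n i e
  applyUpTo∈tails zero {e = suc _} anti bnd lt = here refl
  applyUpTo∈tails (suc n) {i} {g = g} anti bnd lt = ∈tails⁺ {n} lt (bnd z<s)
    (applyUpTo∈tails n (anti ∘ suc)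
      (λ {k} k<n → subst (λ m → g (suc k) < part Λ (suc m)) (sym (+-suc k i)) (bnd (s<s k<n))) (s≤s (anti 0)))

  -- Hook products of paths.

  Keep : ℕ → ℕ → ℕ → ℕ → Set
  Keep i a e j = j < part Λ i × ¬ (a ≤ j × j < e)

  keep? : ∀ i a e j → Dec (Keep i a e j)
  keep? i a e j = (j <? part Λ i) ×-dec ¬? ((a ≤? j) ×-dec (j <? e))

  -- The path occupies the columns from a to e - 1 of row i, none if a = e; the hooks of the other
  -- cells of the row are multiplied.
  rowWeight : ℕ → ℕ → ℕ → ℕ
  rowWeight i a e = product (map (λ j → factor (keep? i a e j) (hook Λ (i , j))) (upTo (part Λ 0)))

  -- The list holds the left ends of the path from row i on. An empty list marks the last row, where
  -- the path starts in column 0.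
  weight : ℕ → ℕ → List ℕ → ℕ
  weight i e []       = rowWeight i 0 e
  weight i e (a ∷ as) = rowWeight i a e * weight (suc i) (suc a) as

  -- With n rows below row i, this is K(i,e) of the idea above: the paths end at
  -- the e-th cell of row i, whose column index is e - 1, and e = 0 gives 0.
  pathSum : ℕ → ℕ → ℕ → ℕ
  pathSum n i e = sum (map (weight i e) (tails n i e))

  pathSum-suc : ∀ n i e → pathSum (suc n) i e ≡
    sum (map (λ a → rowWeight i a e * pathSum n (suc i) (suc a)) (upTo (e ⊓ part Λ (suc i))))
  pathSum-suc n i e = trans (sum-concatMap (weight i e) _ (upTo (e ⊓ part Λ (suc i))))
    (cong sum (map-cong (λ a → trans (cong sum (sym (map-∘ (tails n (suc i) (suc a)))))
      (sum-map-* (rowWeight i a e) (weight (suc i) (suc a)) (tails n (suc i) (suc a)))) (upTo (e ⊓ part Λ (suc i)))))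

  -- Matches the recursion of `weight` along the left ends with a product over row numbers, k being
  -- counted from row i.
  product-rows : ∀ {n} i e as (F : ℕ → ℕ) → length as ≡ n →
    (∀ k → F k ≡ rowWeight (k + i) (partAt as k) (tailEnd e as k)) →
    product (applyUpTo F (suc n)) ≡ weight i e as
  product-rows i e []       F refl eq = trans (*-identityʳ (F 0)) (eq 0)
  product-rows i e (a ∷ as) F refl eq = cong₂ _*_ (eq 0)
    (product-rows (suc i) (suc a) as (F ∘ suc) refl λ k →
      trans (eq (suc k)) (cong₂ (λ m e → rowWeight m (partAt as k) e) (sym (+-suc k i)) (tailEnd-suc k)))
    where
    tailEnd-suc : ∀ k → suc (partAt (a ∷ as) k) ≡ tailEnd (suc a) as k
    tailEnd-suc zero    = refl
    tailEnd-suc (suc k) = refl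

  -- The three filters (in the diagram, off the path, not in row 0) become factors, so the product
  -- splits into rows. Row 0 contributes 1, and n + 1 rows remain.
  lowerHooks-offPath : ∀ {n r as} → L ≡ 2 + n → length as ≡ n →
                       lowerHooks Λ (offPath (partAt (r ∷ as))) ≡ weight 1 (suc r) as
  lowerHooks-offPath {n} {r} {as} L≡ len = begin
    product (map (hook Λ) (filter low? (offPath f)))
      ≡⟨ product-filter low? (hook Λ) (offPath f) ⟩
    product (map g₁ (offPath f))
      ≡⟨ product-filter off? g₁ (𝔻 Λ) ⟩
    product (map g₂ (𝔻 Λ))
      ≡⟨ product-filter (inRow? Λ) g₂ (cartesianProduct (upTo L) (upTo (part Λ 0))) ⟩
    product (map g₃ (cartesianProduct (upTo L) (upTo (part Λ 0))))
      ≡⟨ product-cartesian g₃ (upTo L) (upTo (part Λ 0)) ⟩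
    product (map F (upTo L))
      ≡⟨ cong (λ m → product (map F (upTo m))) L≡ ⟩
    F 0 * product (map F (applyUpTo suc (suc n)))
      ≡⟨ cong₂ _*_ F0≡1 (cong product (map-applyUpTo suc F (suc n))) ⟩
    1 * product (applyUpTo (F ∘ suc) (suc n))
      ≡⟨ *-identityˡ _ ⟩
    product (applyUpTo (F ∘ suc) (suc n))
      ≡⟨ product-rows 1 (suc r) as (F ∘ suc) len row ⟩
    weight 1 (suc r) as ∎
    where
    open ≡-Reasoning
    f : ℕ → ℕ
    f = partAt (r ∷ as)
    low? : Decidable (λ (c : Cell) → proj₁ c ≢ 0)
    low? c = ¬? (proj₁ c ≟ 0)
    off? : Decidable (λ c → ¬ OnPath f c)
    off? c = ¬? (onPath? f c)
    g₁ g₂ g₃ : Cell → ℕ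
    g₁ c = factor (low? c) (hook Λ c)
    g₂ c = factor (off? c) (g₁ c)
    g₃ c = factor (inRow? Λ c) (g₂ c)
    F : ℕ → ℕ
    F i = product (map (λ j → g₃ (i , j)) (upTo (part Λ 0)))
    F0≡1 : F 0 ≡ 1
    F0≡1 = product-ones (λ j → trans (cong (factor (inRow? Λ (0 , j))) (factor-1 (off? (0 , j))))
                                       (factor-1 (inRow? Λ (0 , j)))) (upTo (part Λ 0))
    row : ∀ k → F (suc k) ≡ rowWeight (k + 1) (partAt as k) (tailEnd (suc r) as k)
    row k rewrite +-comm k 1 = cong product (map-cong (λ j → trans
      (factor-× (inRow? Λ (suc k , j)) (off? (suc k , j)) (g₁ (suc k , j)))
      (factor-cong (inRow? Λ (suc k , j) ×-dec off? (suc k , j)) (keep? (suc k) (partAt as k) (tailEnd (suc r) as k) j)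
        (mk⇔ (λ (p , off) → p , λ (q₁ , q₂) → off (q₁ , subst (j <_) (sym (e≡ k)) q₂))
             (λ (p , off) → p , λ (q₁ , q₂) → off (q₁ , subst (j <_) (e≡ k) q₂))) _)) (upTo (part Λ 0)))
      where
      e≡ : ∀ k → end f (suc k) ≡ tailEnd (suc r) as k
      e≡ zero    = refl
      e≡ (suc k) = refl

  -- Legs, hooks and columns.

  LegRow : ℕ → ℕ → ℕ → Set
  LegRow i j k = i < k × j < part Λ k

  legRow? : ∀ i j k → Dec (LegRow i j k)
  legRow? i j k = (i <? k) ×-dec (j <? part Λ k)

  legRows : ℕ → ℕ → List ℕ
  legRows i j = filter (legRow? i j) (upTo L)

  leg : ℕ → ℕ → ℕ
  leg i j = length (legRows i j)

  ∈legRows⁺ : ∀ {i j k} → i < k → j < part Λ k → k ∈ legRows i j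
  ∈legRows⁺ {i} {j} i<k lt = ∈-filter⁺ (legRow? i j) (∈-upTo⁺ (partAt-<-length (parts Λ) lt)) (i<k , lt)

  ∈legRows⁻ : ∀ {i j k} → k ∈ legRows i j → LegRow i j k
  ∈legRows⁻ {i} {j} k∈ = proj₂ (∈-filter⁻ (legRow? i j) {xs = upTo L} k∈)

  legRows-unique : ∀ i j → Unique (legRows i j)
  legRows-unique i j = Unique.filter⁺ _ (Unique.upTo⁺ L)

  leg-antitone : ∀ i {j k} → j ≤ k → leg i k ≤ leg i j
  leg-antitone i {j} {k} j≤k = length-filter-⊆ (legRow? i k) (legRow? i j) (λ (p , q) → p , ≤-<-trans j≤k q) (upTo L)

  leg-zero : ∀ {i j} → part Λ (suc i) ≤ j → leg i j ≡ 0
  leg-zero {i} {j} le = cong length (filter-none (legRow? i j) {xs = upTo L}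
    (All.tabulate λ _ (p , q) → <⇒≱ q (≤-trans (part-≥ p) le)))

  leg-positive : ∀ {i j} → j < part Λ (suc i) → 0 < leg i j
  leg-positive lt = ∈-length (∈legRows⁺ ≤-refl lt)

  -- The first summand is arm + 1: it counts the cell itself, and the leg counts only the rows
  -- strictly below. The inequality treats the two summands separately.
  hook≡arm+leg : ∀ {i j} → j < part Λ i → hook Λ (i , j) ≡ part Λ i ∸ j + leg i j
  hook≡arm+leg {i} {j} lt = begin
    length (filter (inHook? (i , j)) (𝔻 Λ))
      ≡⟨ ↭-length (unique-↭ (Unique.filter⁺ _ (𝔻-unique Λ)) unique (mk⇔ fwd bwd)) ⟩
    length (map (i ,_) arms ++ map (_, j) (legRows i j))
      ≡⟨ length-++ (map (i ,_) arms) ⟩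
    length (map (i ,_) arms) + length (map (_, j) (legRows i j))
      ≡⟨ cong₂ _+_ (trans (length-map {B = Cell} (i ,_) arms) (length-filter-≥ j (part Λ i))) (length-map (_, j) (legRows i j)) ⟩
    part Λ i ∸ j + leg i j ∎
    where
    open ≡-Reasoning
    arms : List ℕ
    arms = filter (j ≤?_) (upTo (part Λ i))
    unique : Unique (map (i ,_) arms ++ map (_, j) (legRows i j))
    unique = Unique.++⁺ (Unique.map⁺ (cong proj₂) (Unique.filter⁺ (j ≤?_) (Unique.upTo⁺ (part Λ i))))
      (Unique.map⁺ (cong proj₁) (legRows-unique i j)) λ (p , q) → disjoint (∈-map⁻ (i ,_) p) (∈-map⁻ (_, j) q)
      where
      disjoint : ∀ {c} → ∃[ l ] l ∈ arms × c ≡ (i , l) → ∃[ k ] k ∈ legRows i j × c ≡ (k , j) → ⊥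
      disjoint (_ , _ , refl) (_ , k∈ , refl) = <-irrefl refl (proj₁ (∈legRows⁻ k∈))
    fwd : ∀ {c} → c ∈ filter (inHook? (i , j)) (𝔻 Λ) → c ∈ map (i ,_) arms ++ map (_, j) (legRows i j)
    fwd {k , l} c∈ with ∈-filter⁻ (inHook? (i , j)) {xs = 𝔻 Λ} c∈
    ... | c∈Λ , inj₁ (refl , j≤l) = ∈-++⁺ˡ (∈-map⁺ (i ,_) (∈-filter⁺ (j ≤?_) (∈-upTo⁺ (∈𝔻⁻ c∈Λ)) j≤l))
    ... | c∈Λ , inj₂ (refl , i≤k) with i ≟ k
    ...   | yes refl = ∈-++⁺ˡ (∈-map⁺ (i ,_) (∈-filter⁺ (j ≤?_) (∈-upTo⁺ lt) ≤-refl))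
    ...   | no  i≢k  = ∈-++⁺ʳ _ (∈-map⁺ (_, j) (∈legRows⁺ (≤∧≢⇒< i≤k i≢k) (∈𝔻⁻ c∈Λ)))
    bwd : ∀ {c} → c ∈ map (i ,_) arms ++ map (_, j) (legRows i j) → c ∈ filter (inHook? (i , j)) (𝔻 Λ)
    bwd c∈ with ∈-++⁻ (map (i ,_) arms) c∈
    ... | inj₁ p with ∈-map⁻ (i ,_) p
    ...   | l , l∈ , refl with ∈-filter⁻ (j ≤?_) {xs = upTo (part Λ i)} l∈
    ...     | l∈′ , j≤l = ∈-filter⁺ (inHook? (i , j)) (∈𝔻⁺ (∈-upTo⁻ l∈′)) (inj₁ (refl , j≤l))
    bwd c∈ | inj₂ p with ∈-map⁻ (_, j) p
    ...   | k , k∈ , refl with ∈legRows⁻ k∈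
    ...     | i<k , lt′ = ∈-filter⁺ (inHook? (i , j)) (∈𝔻⁺ lt′) (inj₂ (refl , <⇒≤ i<k))

  hook-positive : ∀ {i j} → j < part Λ i → 0 < hook Λ (i , j)
  hook-positive {i} {j} lt rewrite hook≡arm+leg lt = <-≤-trans (m<n⇒0<n∸m lt) (m≤m+n _ (leg i j))

  conjugate≡2+leg : ∀ {j} → j < part Λ 1 → conjugate Λ j ≡ 2 + leg 1 j
  conjugate≡2+leg {j} lt = trans
    (↭-length (unique-↭ {ys = (0 , j) ∷ (1 , j) ∷ map (_, j) (legRows 1 j)} (Unique.filter⁺ _ (𝔻-unique Λ))
      (((λ ()) ∷ All.tabulate (λ p → λ { refl → low p z≤n })) ∷
        All.tabulate (λ p → λ { refl → low p ≤-refl }) ∷ Unique.map⁺ (cong proj₁) (legRows-unique 1 j))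
      (mk⇔ fwd bwd)))
    (cong (2 +_) (length-map (_, j) (legRows 1 j)))
    where
    low : ∀ {k} → (k , j) ∈ map (_, j) (legRows 1 j) → ¬ (k ≤ 1)
    low p with ∈-map⁻ (_, j) p
    ... | _ , k∈ , refl = <⇒≱ (proj₁ (∈legRows⁻ k∈))
    column : ∀ {k} → j < part Λ k → (k , j) ∈ filter (λ c → proj₂ c ≟ j) (𝔻 Λ)
    column p = ∈-filter⁺ (λ c → proj₂ c ≟ j) (∈𝔻⁺ p) refl
    fwd : ∀ {c} → c ∈ filter (λ c → proj₂ c ≟ j) (𝔻 Λ) → c ∈ (0 , j) ∷ (1 , j) ∷ map (_, j) (legRows 1 j)
    fwd {k , l} c∈ with ∈-filter⁻ (λ c → proj₂ c ≟ j) {xs = 𝔻 Λ} c∈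
    fwd {zero , l}        c∈ | _ , refl = here refl
    fwd {suc zero , l}    c∈ | _ , refl = there (here refl)
    fwd {suc (suc k) , l} c∈ | c∈Λ , refl = there (there (∈-map⁺ (_, l) (∈legRows⁺ (s<s z<s) (∈𝔻⁻ c∈Λ))))
    bwd : ∀ {c} → c ∈ (0 , j) ∷ (1 , j) ∷ map (_, j) (legRows 1 j) → c ∈ filter (λ c → proj₂ c ≟ j) (𝔻 Λ)
    bwd (here refl) = column (<-≤-trans lt (part-antitone 0))
    bwd (there (here refl)) = column lt
    bwd (there (there p)) with ∈-map⁻ (_, j) p
    ... | k , k∈ , refl = column (proj₂ (∈legRows⁻ k∈))

  -- By `conjugate≡2+leg` a column has height 2 when it reaches row 1 but not row 2. As rows 0 and 1
  -- have equal length, these are the columns from `part Λ 2` on.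
  w≡ : part Λ 0 ≡ part Λ 1 → 0 < part Λ 0 → w Λ ≡ part Λ 0 ∸ part Λ 2
  w≡ top pos = begin
    length (filter (λ j → conjugate Λ j ≟ 2) (upTo (suc (pred (part Λ 0)))))
      ≡⟨ cong (λ m → length (filter (λ j → conjugate Λ j ≟ 2) (upTo m))) (suc-pred (part Λ 0) {{>-nonZero pos}}) ⟩
    length (filter (λ j → conjugate Λ j ≟ 2) (upTo (part Λ 0)))
      ≡⟨ cong length (filter-cong-∈ _ (part Λ 2 ≤?_) (upTo (part Λ 0)) (λ j∈ → short (subst (_ <_) top (∈-upTo⁻ j∈)))) ⟩
    length (filter (part Λ 2 ≤?_) (upTo (part Λ 0)))
      ≡⟨ length-filter-≥ (part Λ 2) (part Λ 0) ⟩
    part Λ 0 ∸ part Λ 2 ∎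
    where
    open ≡-Reasoning
    short : ∀ {j} → j < part Λ 1 → conjugate Λ j ≡ 2 ⇔ part Λ 2 ≤ j
    short {j} lt = mk⇔
      (λ c≡2 → ≮⇒≥ λ j< → <⇒≢ (leg-positive j<) (sym (+-cancelˡ-≡ 2 _ 0 (trans (sym (conjugate≡2+leg lt)) c≡2))))
      (λ le → trans (conjugate≡2+leg lt) (cong (2 +_) (leg-zero le)))

  -- Recurrence for the path sums.

  fullRow : ℕ → ℕ
  fullRow i = rowWeight i 0 0

  -- This is R_i: an empty interval of columns removes no cell, wherever it is placed.
  rowWeight-empty : ∀ i a → rowWeight i a a ≡ fullRow i
  rowWeight-empty i a = cong product (map-cong (λ j → factor-cong (keep? i a a j) (keep? i 0 0 j)
    (mk⇔ (λ (p , _) → p , λ ()) (λ (p , _) → p , λ (q₁ , q₂) → <⇒≱ q₂ q₁)) _) (upTo (part Λ 0)))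

  -- Only the cell (i , e) is added to the path, so multiplying by its hook restores the missing
  -- factor.
  rowWeight-step : ∀ {i a e} → a ≤ e → e < part Λ i → hook Λ (i , e) * rowWeight i a (suc e) ≡ rowWeight i a e
  rowWeight-step {i} {a} {e} a≤e e<p = trans (cong (_* rowWeight i a (suc e)) (sym kept))
    (product-update (<-≤-trans e<p (part-≥ z≤n)) (λ {j} j≢e → factor-cong (keep? i a (suc e) j) (keep? i a e j)
      (mk⇔ (λ (p , ¬q) → p , λ (q₁ , q₂) → ¬q (q₁ , m≤n⇒m≤1+n q₂))
           (λ (p , ¬q) → p , λ (q₁ , q₂) → ¬q (q₁ , ≤∧≢⇒< (s≤s⁻¹ q₂) j≢e))) _) dropped)
    where
    kept : factor (keep? i a e e) (hook Λ (i , e)) ≡ hook Λ (i , e)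
    kept with keep? i a e e
    ... | yes _ = refl
    ... | no ¬k = contradiction (e<p , λ (_ , q) → <-irrefl refl q) ¬k
    dropped : factor (keep? i a (suc e) e) (hook Λ (i , e)) ≡ 1
    dropped with keep? i a (suc e) e
    ... | yes (_ , ¬q) = contradiction (a≤e , ≤-refl) ¬q
    ... | no _ = refl

  rowWeight-positive : ∀ i a e → 0 < rowWeight i a e
  rowWeight-positive i a e = product-positive
    (λ j → factor-positive (keep? i a e j) (λ (p , _) → hook-positive p)) (upTo (part Λ 0))

  -- Splitting by the last step: a path to (i , e) arrives from the left if it enters row i before
  -- column e, and from (i + 1 , e) otherwise.
  pathSum-inner : ∀ n {i e} → e < part Λ (suc i) →
    hook Λ (i , e) * pathSum (suc n) i (suc e) ≡ pathSum (suc n) i e + fullRow i * pathSum n (suc i) (suc e)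
  pathSum-inner n {i} {e} lt = begin
    h * pathSum (suc n) i (suc e)
      ≡⟨ cong (h *_) (trans (pathSum-suc n i (suc e)) (cong (λ m → sum (map (G (suc e)) (upTo m))) (m≤n⇒m⊓n≡m lt))) ⟩
    h * sum (map (G (suc e)) (upTo (suc e)))
      -- The summand a = e, split off here, collects the paths that enter row i at (i , e) itself.
      ≡⟨ cong (h *_) (sum-upTo-suc (G (suc e)) e) ⟩
    h * (sum (map (G (suc e)) (upTo e)) + G (suc e) e)
      ≡⟨ *-distribˡ-+ h _ _ ⟩
    h * sum (map (G (suc e)) (upTo e)) + h * G (suc e) e
      ≡⟨ cong₂ _+_ (sum-map-* h (G (suc e)) (upTo e)) (*-assoc h (rowWeight i e (suc e)) _) ⟨
    sum (map (λ a → h * G (suc e) a) (upTo e)) + h * rowWeight i e (suc e) * u e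
      ≡⟨ cong₂ _+_ (cong sum (map-cong-∈ (upTo e) (λ a∈ → step (<⇒≤ (∈-upTo⁻ a∈)))))
                   (cong (_* u e) (trans (rowWeight-step ≤-refl lt′) (rowWeight-empty i e))) ⟩
    sum (map (G e) (upTo e)) + fullRow i * u e
      ≡⟨ cong (_+ fullRow i * u e) (trans (pathSum-suc n i e) (cong (λ m → sum (map (G e) (upTo m))) (m≤n⇒m⊓n≡m (<⇒≤ lt)))) ⟨
    pathSum (suc n) i e + fullRow i * u e ∎
    where
    open ≡-Reasoning
    lt′ = <-≤-trans lt (part-antitone i)
    h = hook Λ (i , e)
    u : ℕ → ℕ
    u a = pathSum n (suc i) (suc a)
    G : ℕ → ℕ → ℕ
    G e a = rowWeight i a e * u a
    step : ∀ {a} → a ≤ e → h * G (suc e) a ≡ G e a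
    step {a} a≤e = trans (sym (*-assoc h (rowWeight i a (suc e)) (u a))) (cong (_* u a) (rowWeight-step a≤e lt′))

  -- There is no cell below (i , e), so the last step comes from the left. The bound 0 < e matters
  -- in the last row, where a path may begin at (i , 0).
  pathSum-outer : ∀ n {i e} → 0 < e → part Λ (suc i) ≤ e → e < part Λ i →
                  hook Λ (i , e) * pathSum n i (suc e) ≡ pathSum n i e
  pathSum-outer zero {i} {suc e} _ _ lt = trans (cong (hook Λ (i , suc e) *_) (+-identityʳ _))
    (trans (rowWeight-step z≤n lt) (sym (+-identityʳ _)))
  pathSum-outer (suc n) {i} {e} _ le lt = begin
    h * pathSum (suc n) i (suc e)
      ≡⟨ cong (h *_) (trans (pathSum-suc n i (suc e)) (cong (λ m → sum (map (G (suc e)) (upTo m))) (m≥n⇒m⊓n≡n (m≤n⇒m≤1+n le)))) ⟩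
    h * sum (map (G (suc e)) (upTo p))
      ≡⟨ sum-map-* h (G (suc e)) (upTo p) ⟨
    sum (map (λ a → h * G (suc e) a) (upTo p))
      ≡⟨ cong sum (map-cong-∈ (upTo p) (λ a∈ → step (<⇒≤ (<-≤-trans (∈-upTo⁻ a∈) le)))) ⟩
    sum (map (G e) (upTo p))
      ≡⟨ trans (pathSum-suc n i e) (cong (λ m → sum (map (G e) (upTo m))) (m≥n⇒m⊓n≡n le)) ⟨
    pathSum (suc n) i e ∎
    where
    open ≡-Reasoning
    p = part Λ (suc i)
    h = hook Λ (i , e)
    u : ℕ → ℕ
    u a = pathSum n (suc i) (suc a)
    G : ℕ → ℕ → ℕ
    G e a = rowWeight i a e * u a
    step : ∀ {a} → a ≤ e → h * G (suc e) a ≡ G e a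
    step {a} a≤e = trans (sym (*-assoc h (rowWeight i a (suc e)) (u a))) (cong (_* u a) (rowWeight-step a≤e lt))

  pathSum-zero : ∀ n i → pathSum n i 0 ≡ 0
  pathSum-zero zero    i = refl
  pathSum-zero (suc n) i = refl

  part-positive : ∀ {i} → i < L → 0 < part Λ i
  part-positive = partAt-positive (positive Λ)

  -- The path straight up column 0 exists. If the sum vanished, the recurrence at column 0 would
  -- make R_i times the sum one row below vanish as well.
  pathSum-positive : ∀ n i → n + suc i ≡ L → 0 < pathSum n i 1
  pathSum-positive zero    i eq = <-≤-trans (rowWeight-positive i 0 1) (m≤m+n _ 0)
  pathSum-positive (suc n) i eq = n≢0⇒n>0 λ z → <⇒≢
    (*-mono-< (rowWeight-positive i 0 0) (pathSum-positive n (suc i) (trans (+-suc n (suc i)) eq)))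
    (sym (trans (sym (pathSum-inner n (part-positive (subst (suc i <_) eq (s≤s (m≤n+m (suc i) n))))))
      (trans (cong (hook Λ (i , 0) *_) z) (*-zeroʳ (hook Λ (i , 0))))))

  -- The inequality for path sums.

  private
    -- Here a is arm + 1 and b the leg. After multiplication by the hook a + b, the recurrence turns
    -- the right side into a t₀ + a x, and a t₀ occurs on both sides.
    cancel-step : ∀ a b t t₀ x → (a + b) * t ≡ t₀ + x → b * t₀ < a * x → t₀ < a * t
    cancel-step a b t t₀ x eq lt = *-cancelˡ-< (a + b) t₀ (a * t) (begin-strict
      (a + b) * t₀       ≡⟨ *-distribʳ-+ t₀ a b ⟩
      a * t₀ + b * t₀    <⟨ +-monoʳ-< (a * t₀) lt ⟩
      a * t₀ + a * x     ≡⟨ *-distribˡ-+ a t₀ x ⟨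
      a * (t₀ + x)       ≡⟨ cong (a *_) eq ⟨
      a * ((a + b) * t)  ≡⟨ *-assoc a (a + b) t ⟨
      a * (a + b) * t    ≡⟨ cong (_* t) (*-comm a (a + b)) ⟩
      (a + b) * a * t    ≡⟨ *-assoc (a + b) a t ⟩
      (a + b) * (a * t)  ∎)
      where open ≤-Reasoning

    -- Since a t + b t = t₀ + x < a t + x, the term a t cancels.
    leg-step : ∀ a b t t₀ x → (a + b) * t ≡ t₀ + x → t₀ < a * t → b * t < x
    leg-step a b t t₀ x eq lt = +-cancelˡ-< (a * t) (b * t) x (begin-strict
      a * t + b * t  ≡⟨ *-distribʳ-+ t a b ⟨
      (a + b) * t    ≡⟨ eq ⟩
      t₀ + x         <⟨ +-monoˡ-< x lt ⟩
      a * t + x      ∎)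
      where open ≤-Reasoning

  -- If (i + 1 , e) is not a cell, the leg is 0, the hook is arm + 1 and `pathSum-outer` gives
  -- equality for e > 0. At e = 0 the left side is 0.
  pathSum-≤ : ∀ n i e → n + suc i ≡ L → e < part Λ i → pathSum n i e ≤ (part Λ i ∸ e) * pathSum n i (suc e)
  -- Induction on the column and on the number of rows below. At e = 0 strictness comes from
  -- `pathSum-positive`, and each step to the right preserves it.
  pathSum-< : ∀ n i e → suc n + suc i ≡ L → e < part Λ (suc i) →
              pathSum (suc n) i e < (part Λ i ∸ e) * pathSum (suc n) i (suc e)

  pathSum-≤ n i zero eq lt rewrite pathSum-zero n i = z≤n
  pathSum-≤ n i (suc e) eq lt with suc e <? part Λ (suc i)
  pathSum-≤ zero i (suc e) eq lt | yes lt′ = contradiction (partAt-<-length (parts Λ) lt′) (≤⇒≯ (≤-reflexive (sym eq)))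
  pathSum-≤ (suc n) i (suc e) eq lt | yes lt′ = <⇒≤ (pathSum-< n i (suc e) eq lt′)
  pathSum-≤ n i (suc e) eq lt | no ge = ≤-reflexive (trans (sym (pathSum-outer n z<s (≮⇒≥ ge) lt))
    (cong (_* pathSum n i (suc (suc e))) (trans (hook≡arm+leg lt)
      (trans (cong (part Λ i ∸ suc e +_) (leg-zero (≮⇒≥ ge))) (+-identityʳ _)))))

  pathSum-< n i zero eq lt rewrite pathSum-zero (suc n) i =
    *-mono-< (<-≤-trans lt (part-antitone i)) (pathSum-positive (suc n) i eq)
  pathSum-< n i (suc e) eq lt = cancel-step (part Λ i ∸ suc e) (leg i (suc e)) _ _ _
    (trans (cong (_* pathSum (suc n) i (suc (suc e))) (sym (hook≡arm+leg (<-≤-trans lt (part-antitone i)))))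
           (pathSum-inner n lt))
    (begin-strict
      -- The column to the left is at least as long.
      leg i (suc e) * t₀               ≤⟨ *-monoˡ-≤ t₀ (leg-antitone i (n≤1+n e)) ⟩
      -- The strict bound one column to the left, rewritten by the recurrence there.
      leg i e * t₀                     <⟨ leg-step (part Λ i ∸ e) (leg i e) t₀ _ _
                                            (trans (cong (_* t₀) (sym (hook≡arm+leg (<-≤-trans lt′ (part-antitone i)))))
                                                   (pathSum-inner n lt′))
                                            (pathSum-< n i e eq lt′) ⟩
      fullRow i * pathSum n (suc i) (suc e)
        -- The weak bound one row below, whose arm is at most the arm in row i.
        ≤⟨ *-monoʳ-≤ (fullRow i) (≤-trans (pathSum-≤ n (suc i) (suc e) (trans (+-suc n (suc i)) eq) lt)
             (*-monoˡ-≤ u (∸-monoˡ-≤ (suc e) (part-antitone i)))) ⟩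
      fullRow i * (a * u)              ≡⟨ *-assoc (fullRow i) a u ⟨
      fullRow i * a * u                ≡⟨ cong (_* u) (*-comm (fullRow i) a) ⟩
      a * fullRow i * u                ≡⟨ *-assoc a (fullRow i) u ⟩
      a * (fullRow i * u)              ∎)
    where
    open ≤-Reasoning
    lt′ = <⇒≤ lt
    t₀ = pathSum (suc n) i (suc e)
    u = pathSum n (suc i) (suc (suc e))
    a = part Λ i ∸ suc e

  -- Coefficients as path sums.

  module Coefficients (μ : Partition) (inner : ∀ {c} → c ∈ 𝔻 Λ → c ∈ 𝔻 μ ⇔ diagonal c ∈ 𝔻 Λ) where
    open ExcitedProfiles μ inner

    -- An excited diagram with r cells in row 0 is the complement of a path with `f 0` equal to r,
    -- determined by the next n left ends. Such a path leaves row 1 in column r, whence the bound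
    -- `suc r`.
    C≡pathSum : ∀ {n} j → L ≡ 2 + n → s Λ ∸ j < part Λ 1 → C Λ μ j ≡ pathSum n 1 (suc (s Λ ∸ j))
    C≡pathSum {n} j L≡ r<p = begin
      sum (map (lowerHooks Λ) (filter (λ D → inTopRow D ≟ r) (𝔼 Λ μ)))
        ≡⟨ sum-↭ (map⁺ (lowerHooks Λ) (unique-↭ (Unique.filter⁺ _ (Unique.filter⁺ _ (subsets-unique (𝔻-unique Λ))))
             (unique-map diagram (tails-unique n 1 (suc r)) injective) (mk⇔ fwd bwd))) ⟩
      sum (map (lowerHooks Λ) (map diagram (tails n 1 (suc r))))
        ≡⟨ cong sum (map-∘ (tails n 1 (suc r))) ⟨
      sum (map (lowerHooks Λ ∘ diagram) (tails n 1 (suc r)))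
        ≡⟨ cong sum (map-cong-∈ (tails n 1 (suc r)) λ as∈ → lowerHooks-offPath L≡ (tails-length n as∈)) ⟩
      pathSum n 1 (suc r) ∎
      where
      open ≡-Reasoning
      r = s Λ ∸ j
      diagram : List ℕ → List Cell
      diagram as = offPath (partAt (r ∷ as))
      profile : ∀ {as} → as ∈ tails n 1 (suc r) → Profile (partAt (r ∷ as))
      profile as∈ .Profile.antitone k = tails-antitone n as∈ k
      profile as∈ .Profile.bounded zero = pred-mono-≤ r<p
      profile {as} as∈ .Profile.bounded (suc k) =
        subst (λ m → partAt as k ≤ pred (part Λ (suc m))) (+-comm k 1) (tails-bounded n as∈ k)
      injective : ∀ {as bs} → as ∈ tails n 1 (suc r) → bs ∈ tails n 1 (suc r) → diagram as ≡ diagram bs → as ≡ bs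
      injective p q eq = partAt-ext (trans (tails-length n p) (sym (tails-length n q)))
        (offPath-injective (profile p) (profile q) eq ∘ suc)
      fwd : ∀ {D} → D ∈ filter (λ D → inTopRow D ≟ r) (𝔼 Λ μ) → D ∈ map diagram (tails n 1 (suc r))
      fwd D∈ with ∈-filter⁻ (λ D → inTopRow D ≟ r) {xs = 𝔼 Λ μ} D∈
      ... | D∈𝔼 , top with excited⇒profile (proj₂ (∈-filter⁻ (excited? Λ μ) {xs = subsets (𝔻 Λ)} D∈𝔼))
      ...   | f , P , refl = subst (_∈ map diagram (tails n 1 (suc r))) (sym (offPath-cong f≗))
                (∈-map⁺ diagram (applyUpTo∈tails n (Profile.antitone P ∘ suc) f<part f1<))
        where
        f0 : f 0 ≡ r
        f0 = trans (sym (inTopRow-offPath P)) top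
        f1< : f 1 < suc r
        f1< = s≤s (subst (f 1 ≤_) f0 (Profile.antitone P 0))
        f<part : ∀ {k} → k < n → f (suc k) < part Λ (suc (k + 1))
        f<part {k} k<n rewrite +-comm k 1 = ≤-<-trans (Profile.bounded P (suc k))
          (≤-reflexive (suc-pred _ {{>-nonZero (part-positive (subst (2 + k <_) (sym L≡) (s≤s (s≤s k<n))))}}))
        f≗ : f ≗ partAt (r ∷ applyUpTo (f ∘ suc) n)
        -- After the n listed values no row is left, so the profile is 0 there, the default value of
        -- `partAt`.
        f≗ zero    = f0
        f≗ (suc k) = sym (partAt-applyUpTo (f ∘ suc) n λ n≤k → n≤0⇒n≡0 (≤-trans (Profile.bounded P (suc k))
          (≤-reflexive (cong pred (part-zero (subst (_≤ 2 + k) (sym L≡) (s≤s (s≤s n≤k))))))))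
      bwd : ∀ {D} → D ∈ map diagram (tails n 1 (suc r)) → D ∈ filter (λ D → inTopRow D ≟ r) (𝔼 Λ μ)
      bwd D∈ with ∈-map⁻ diagram D∈
      ... | as , as∈ , refl = ∈-filter⁺ (λ D → inTopRow D ≟ r)
            (∈-filter⁺ (excited? Λ μ) (filter-∈-subsets _ (𝔻 Λ))
              (profile⇒excited L 0 (+-identityʳ L) (profile as∈) λ ()))
            (inTopRow-offPath (profile as∈))

    module _ (top : part Λ 0 ≡ part Λ 1) {j} (j<s : j < s Λ) where

      private
        0<part0 : 0 < part Λ 0
        0<part0 = <-≤-trans (≤-<-trans z≤n j<s) pred[n]≤n
        rows = L ∸ 2
        L≡ : L ≡ 2 + rows
        L≡ = sym (m+[n∸m]≡n (partAt-<-length (parts Λ) (subst (0 <_) top 0<part0)))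
        part0≡ : part Λ 0 ≡ suc (s Λ)
        part0≡ = sym (suc-pred (part Λ 0) {{>-nonZero 0<part0}})
        <part1 : ∀ k → s Λ ∸ k < part Λ 1
        <part1 k = subst (s Λ ∸ k <_) (trans (sym part0≡) top) (s≤s (m∸n≤m (s Λ) k))
        e = s Λ ∸ j
        -- Row 1 has s + 1 cells like row 0, so j + 1 of them lie weakly right of column s - j. This
        -- is the quotient of the two factorials.
        arm : part Λ 1 ∸ e ≡ suc j
        arm = trans (cong (_∸ e) (trans (sym top) part0≡))
          (trans (+-∸-assoc 1 (m∸n≤m (s Λ) j)) (cong suc (m∸[m∸n]≡n (<⇒≤ j<s))))
        Cⱼ : C Λ μ j ≡ pathSum rows 1 (suc e)
        Cⱼ = C≡pathSum j L≡ (<part1 j)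
        -- Passing from j to j + 1 moves the end of the path one column to the left; j < s keeps the
        -- truncated subtraction exact.
        Cⱼ₊₁ : C Λ μ (suc j) ≡ pathSum rows 1 e
        Cⱼ₊₁ = trans (C≡pathSum (suc j) L≡ (<part1 (suc j))) (cong (pathSum rows 1) (sym (+-∸-assoc 1 j<s)))

      -- As w is s + 1 - `part Λ 2`, the assumption says that column e ends in row 1. So (1 , e) has
      -- leg 0 and hook j + 1.
      C-equal : j < w Λ → suc j * C Λ μ j ≡ C Λ μ (suc j)
      C-equal j<w = begin
        suc j * C Λ μ j                          ≡⟨ cong₂ _*_ hook≡ Cⱼ ⟩
        hook Λ (1 , e) * pathSum rows 1 (suc e)  ≡⟨ pathSum-outer rows (m<n⇒0<n∸m j<s) short (<part1 j) ⟩
        pathSum rows 1 e                         ≡⟨ Cⱼ₊₁ ⟨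
        C Λ μ (suc j)                            ∎
        where
        open ≡-Reasoning
        short : part Λ 2 ≤ e
        short = m+n≤o⇒m≤o∸n (part Λ 2) (subst (_≤ s Λ) (+-comm j (part Λ 2)) (s≤s⁻¹ (subst (suc j + part Λ 2 ≤_) part0≡
          (m≤o∸n⇒m+n≤o (suc j) (part-≥ {0} z≤n) (subst (j <_) (w≡ top 0<part0) j<w)))))
        hook≡ : suc j ≡ hook Λ (1 , e)
        hook≡ = sym (trans (hook≡arm+leg (<part1 j)) (trans (cong₂ _+_ arm (leg-zero short)) (+-identityʳ (suc j))))

      -- Now (2 , e) is a cell, so the strict bound applies in row 1.
      C-less : w Λ ≤ j → C Λ μ (suc j) < suc j * C Λ μ j
      C-less w≤j = subst₂ _<_ (sym Cⱼ₊₁) (cong₂ _*_ arm (sym Cⱼ)) (strict rows L≡)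
        where
        tall : e < part Λ 2
        tall = ≰⇒> λ p₂≤e → <⇒≱
          (m+n≤o⇒m≤o∸n (suc j) (s≤s (subst (_≤ s Λ) (+-comm (part Λ 2) j)
            (m≤o∸n⇒m+n≤o (part Λ 2) (<⇒≤ j<s) p₂≤e))))
          (subst (λ m → m ∸ part Λ 2 ≤ j) part0≡ (subst (_≤ j) (w≡ top 0<part0) w≤j))
        -- Stated for every n so that the number of rows can be matched on; with two rows only, (2 ,
        -- e) would not be a cell.
        strict : ∀ n → L ≡ 2 + n → pathSum n 1 e < (part Λ 1 ∸ e) * pathSum n 1 (suc e)
        strict zero    eq = contradiction (partAt-<-length (parts Λ) tall) (≤⇒≯ (≤-reflexive eq))
        strict (suc n) eq = pathSum-< n 1 e (trans (+-comm (suc n) 2) (sym eq)) tall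

-- Fractions, the shape condition and the theorem.

/-cong-* : ∀ a b m n .{{_ : NonZero m}} .{{_ : NonZero n}} → a * n ≡ b * m → ℤ.+ a ℚ./ m ≡ ℤ.+ b ℚ./ n
/-cong-* a b m@(suc _) n@(suc _) eq = ℚ.fromℚᵘ-cong {ℚᵘ.mkℚᵘ (ℤ.+ a) _} {ℚᵘ.mkℚᵘ (ℤ.+ b) _}
  (ℚᵘ.*≡* (trans (sym (ℤ.pos-* a n)) (trans (cong ℤ.+_ eq) (ℤ.pos-* b m))))

/-mono-* : ∀ a b m n .{{_ : NonZero m}} .{{_ : NonZero n}} → a * n < b * m → ℤ.+ a ℚ./ m ℚ.< ℤ.+ b ℚ./ n
/-mono-* a b m@(suc _) n@(suc _) lt = ℚ.toℚᵘ-cancel-<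
  (ℚᵘ.<-respˡ-≃ (ℚᵘ.≃-sym (ℚ.toℚᵘ-fromℚᵘ p)) (ℚᵘ.<-respʳ-≃ (ℚᵘ.≃-sym (ℚ.toℚᵘ-fromℚᵘ q))
    (ℚᵘ.*<* (subst₂ ℤ._<_ (ℤ.pos-* a n) (ℤ.pos-* b m) (ℤ.+<+ lt)))))
  where
  p = ℚᵘ.mkℚᵘ (ℤ.+ a) (pred m)
  q = ℚᵘ.mkℚᵘ (ℤ.+ b) (pred n)

-- If the diagonal neighbour is in Λ, so are the right and lower ones. Hence a cell is on the rim
-- exactly when its diagonal neighbour is missing, and the rim is the complement of μ.
inner⇔diagonal : ∀ {I Λ μ} → IsShapeOf I Λ μ → ∀ {c} → c ∈ 𝔻 Λ → c ∈ 𝔻 μ ⇔ diagonal c ∈ 𝔻 Λ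
inner⇔diagonal {I} {Λ} {μ} S {c} c∈Λ = mk⇔
  (λ c∈μ → decidable-stable (diagonal c ∈ᶜ? 𝔻 Λ) λ d∉ →
    proj₂ (to (difference c) (from (rim c)
      (c∈Λ , filter-notAll (_∈ᶜ? 𝔻 Λ) _ (there (there (here d∉)))))) c∈μ)
  (λ d∈ → decidable-stable (c ∈ᶜ? 𝔻 μ) λ c∉μ →
    <-irrefl (cong length (filter-all (_∈ᶜ? 𝔻 Λ) (neighbours d∈))) (proj₂ (to (rim c) (from (difference c) (c∈Λ , c∉μ)))))
  where
  open IsShapeOf S
  open Diagram Λ
  neighbours : diagonal c ∈ 𝔻 Λ → All (_∈ 𝔻 Λ) (right c ∷ below c ∷ diagonal c ∷ [])
  neighbours d∈ = ∈𝔻⁺ (<-≤-trans (∈𝔻⁻ d∈) (part-antitone (proj₁ c))) ∷ ∈𝔻⁺ (<⇒≤ (∈𝔻⁻ d∈)) ∷ d∈ ∷ []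

theorem4p5 : (I : DescentSet) (Λ μ : Partition) → IsShapeOf I Λ μ →
    (∀ (j : ℕ) → j < w Λ ⊓ s Λ → C/! Λ μ j ≡ C/! Λ μ (suc j))
    × (∀ (j : ℕ) → w Λ ≤ j → j < s Λ → C/! Λ μ j > C/! Λ μ (suc j))
theorem4p5 I Λ μ S =
    (λ j lt → /-cong-* (C Λ μ j) (C Λ μ (suc j)) (j !) (suc j !) {{j !≢0}} {{suc j !≢0}}
      (trans (cross j) (cong (_* j !) (C-equal topRows (m<n⊓o⇒m<o (w Λ) (s Λ) lt) (m<n⊓o⇒m<n (w Λ) (s Λ) lt)))))
  , (λ j w≤j j<s → /-mono-* (C Λ μ (suc j)) (C Λ μ j) (suc j !) (j !) {{suc j !≢0}} {{j !≢0}}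
      (subst (C Λ μ (suc j) * j ! <_) (sym (cross j)) (*-monoˡ-< (j !) {{j !≢0}} (C-less topRows j<s w≤j))))
  where
  open IsShapeOf S
  open Diagram.Coefficients Λ μ (inner⇔diagonal S)
  -- Since (j + 1)! unfolds to (j + 1) j!, cross-multiplication leaves a common factor j! in the
  -- comparison of (j + 1) C_j with C_{j+1}.
  cross : ∀ j → C Λ μ j * (suc j * j !) ≡ suc j * C Λ μ j * j !
  cross j = trans (sym (*-assoc (C Λ μ j) (suc j) (j !))) (cong (_* j !) (*-comm (C Λ μ j) (suc j)))
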